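{- Let $G=(V,E)$ be a finite undirected simple graph with an even number of vertices, and let $\mathrm{perfmat}\, G$ denote the number of perfect matchings of $G$. Then $$\mathrm{perfmat}\, G \le \prod_{v\in V} \big((\deg v)!\big)^{\frac{1}{2\deg v}},$$ with the convention $0^{1/0}=0$ (so the right-hand side is $0$ if some vertex has degree $0$). Equivalently, for every symmetric matrix $A\in\{0,1\}^{2n\times 2n}$ with zero diagonal and row sums $r_1,\dots,r_{2n}$, $$\mathrm{hafn}\, A \le \prod_{i=1}^{2n} (r_i!)^{\frac{1}{2r_i}}.$$
   Context: For a real symmetric $2n\times 2n$ matrix $A=[a_{ij}]$, the hafnian is $\mathrm{hafn}\, A=\sum \prod_{k=1}^n a_{i_kj_k}$, where the sum runs over all partitions $\{\{i_1,j_1\},\dots,\{i_n,j_n\}\}$ of $\{1,\dots,2n\}$ into $n$ pairs (with $i_k<j_k$), i.e. over all perfect matchings of the complete graph $K_{2n}$. For the adjacency matrix $A(G)$ of a graph $G$ on vertex set $\{1,\dots,2n\}$, $\mathrm{hafn}\,A(G)=\mathrm{perfmat}\,G$, and the $i$-th row sum $r_i$ is $\deg i$. -}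

module Defs where

open import Data.Bool.Base using (true; false; if_then_else_)
open import Data.Fin.Base as Fin using (Fin)
import Data.Fin.Properties as Fin
open import Data.Integer.Base as ℤ using (+_; +≤+)
import Data.Integer.Properties as ℤ
open import Data.List.Base
  using (List; []; _∷_; _++_; map; filter; length; allFin; cartesianProduct)
open import Data.Nat.Base as ℕ using (ℕ; zero; suc; NonZero)
open import Data.Nat.ListAction using (sum; product)
import Data.Nat.Properties as ℕ
open import Data.Nat.Tactic.RingSolver as ℕ-Solver using ()
open import Data.Product.Base using (Σ; ∃; _×_; _,_; proj₁; proj₂)
open import Data.Rational.Base
  using (ℚ; 0ℚ; 1ℚ; ½; _/_; _+_; _*_; _-_; -_; ∣_∣; _≤_; 1/_; Positive)
import Data.Rational.Base as ℚ
import Data.Rational.Properties as ℚ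
import Data.Rational.Unnormalised.Base as ℚᵘ
import Data.Rational.Unnormalised.Properties as ℚᵘ
open import Data.Sum.Base using (_⊎_; inj₁; inj₂)
open import Data.Vec.Functional using (Vector; foldr)
open import Level using (0ℓ)
open import Relation.Binary.Core using (Rel)
open import Relation.Binary.Definitions using (Decidable; Symmetric; Irreflexive)
open import Relation.Binary.PropositionalEquality
  using (_≡_; refl; sym; trans; cong; cong₂; subst)
open import Relation.Nullary.Decidable using (_⊎-dec_; dec⇒maybe)
open import Relation.Nullary.Reflects using (ofʸ; ofⁿ)
open import Relation.Unary using () renaming (Decidable to Decidable₁)
open import Tactic.RingSolver using (solve-∀)
open import Tactic.RingSolver.Core.AlmostCommutativeRing
  using (AlmostCommutativeRing; fromCommutativeRing)

------------------------------------------------------------------------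
-- Real numbers: Cauchy sequences of rationals, with equality _≃ℝ_

ℚ-ring : AlmostCommutativeRing 0ℓ 0ℓ
ℚ-ring = fromCommutativeRing ℚ.+-*-commutativeRing (λ p → dec⇒maybe (0ℚ ℚ.≟ p))

Cauchy : (ℕ → ℚ) → Set
Cauchy x = ∀ ε → .{{Positive ε}} →
  ∃ λ N → ∀ {m n} → N ℕ.≤ m → N ℕ.≤ n → ∣ x m - x n ∣ ≤ ε

record ℝ : Set where
  constructor mkℝ
  field
    seq    : ℕ → ℚ
    cauchy : Cauchy seq

open ℝ public

infix 4 _≤ℝ_ _≃ℝ_

_≤ℝ_ : Rel ℝ 0ℓ
x ≤ℝ y = ∀ ε → .{{Positive ε}} →
  ∃ λ N → ∀ {n} → N ℕ.≤ n → seq x n ≤ seq y n + ε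

_≃ℝ_ : Rel ℝ 0ℓ
x ≃ℝ y = x ≤ℝ y × y ≤ℝ x

fromℚ : ℚ → ℝ
fromℚ p .seq _ = p
fromℚ p .cauchy ε {{pos}} = 0 , λ _ _ →
  subst (_≤ ε) (sym (cong ∣_∣ (ℚ.+-inverseʳ p))) (ℚ.<⇒≤ (ℚ.positive⁻¹ ε {{pos}}))

fromℕ : ℕ → ℝ
fromℕ n = fromℚ (+ n / 1)

0ℝ 1ℝ : ℝ
0ℝ = fromℕ 0
1ℝ = fromℕ 1

EventuallyBounded : (ℕ → ℚ) → Set
EventuallyBounded x =
  Σ ℚ λ B → Positive B × ∃ λ N → ∀ {n} → N ℕ.≤ n → ∣ x n ∣ ≤ B

cauchy⇒bounded : ∀ {x} → Cauchy x → EventuallyBounded x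
cauchy⇒bounded {x} c with c 1ℚ
... | N , h = B , ℚ.nonNeg+pos⇒pos ∣ x N ∣ {{ℚ.∣-∣-nonNeg (x N)}} 1ℚ , N , λ {n} N≤n → begin
  ∣ x n ∣                    ≡⟨ cong ∣_∣ (split (x n) (x N)) ⟩
  ∣ x N + (x n - x N) ∣      ≤⟨ ℚ.∣p+q∣≤∣p∣+∣q∣ (x N) (x n - x N) ⟩
  ∣ x N ∣ + ∣ x n - x N ∣    ≤⟨ ℚ.+-monoʳ-≤ ∣ x N ∣ (h N≤n ℕ.≤-refl) ⟩
  B                          ∎
  where
  open ℚ.≤-Reasoning
  B : ℚ
  B = ∣ x N ∣ + 1ℚ
  split : ∀ p q → p ≡ q + (p - q)
  split = solve-∀ ℚ-ring

∣ab-cd∣≤ : ∀ {a b c d B C δ} → Positive B → Positive C →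
  ∣ a ∣ ≤ B → ∣ d ∣ ≤ C → ∣ a - c ∣ ≤ δ → ∣ b - d ∣ ≤ δ →
  ∣ a * b - c * d ∣ ≤ (B + C) * δ
∣ab-cd∣≤ {a} {b} {c} {d} {B} {C} {δ} B>0 C>0 a≤ d≤ ac bd = begin
  ∣ a * b - c * d ∣                            ≡⟨ cong ∣_∣ (split a b c d) ⟩
  ∣ a * (b - d) + d * (a - c) ∣                ≤⟨ ℚ.∣p+q∣≤∣p∣+∣q∣ (a * (b - d)) (d * (a - c)) ⟩
  ∣ a * (b - d) ∣ + ∣ d * (a - c) ∣            ≤⟨ ℚ.+-mono-≤ (step a≤ bd B>0) (step d≤ ac C>0) ⟩
  B * δ + C * δ                                ≡⟨ sym (ℚ.*-distribʳ-+ δ B C) ⟩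
  (B + C) * δ                                  ∎
  where
  open ℚ.≤-Reasoning
  split : ∀ p q r s → p * q - r * s ≡ p * (q - s) + s * (p - r)
  split = solve-∀ ℚ-ring
  step : ∀ {p q P} → ∣ p ∣ ≤ P → ∣ q ∣ ≤ δ → Positive P → ∣ p * q ∣ ≤ P * δ
  step {p} {q} {P} p≤ q≤ P>0 = begin
    ∣ p * q ∣       ≡⟨ ℚ.∣p*q∣≡∣p∣*∣q∣ p q ⟩
    ∣ p ∣ * ∣ q ∣   ≤⟨ ℚ.*-monoʳ-≤-nonNeg ∣ q ∣ {{ℚ.∣-∣-nonNeg q}} p≤ ⟩
    P * ∣ q ∣       ≤⟨ ℚ.*-monoˡ-≤-nonNeg P {{ℚ.pos⇒nonNeg P {{P>0}}}} q≤ ⟩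
    P * δ           ∎

∣-∣≤ : ∀ {p q ε} → p ≤ q + ε → q ≤ p + ε → ∣ p - q ∣ ≤ ε
∣-∣≤ {p} {q} {ε} p≤ q≤ with ℚ.∣p∣≡p∨∣p∣≡-p (p - q)
... | inj₁ eq = subst (_≤ ε) (sym eq)
  (subst (p - q ≤_) (cancel q ε) (ℚ.+-monoˡ-≤ (- q) p≤))
  where
  cancel : ∀ q ε → (q + ε) - q ≡ ε
  cancel = solve-∀ ℚ-ring
... | inj₂ eq = subst (_≤ ε) (sym (trans eq (flip p q)))
  (subst (q - p ≤_) (cancel p ε) (ℚ.+-monoˡ-≤ (- p) q≤))
  where
  cancel : ∀ p ε → (p + ε) - p ≡ ε
  cancel = solve-∀ ℚ-ring
  flip : ∀ p q → - (p - q) ≡ q - p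
  flip = solve-∀ ℚ-ring

∣-∣≤⁻ : ∀ {p q ε} → ∣ p - q ∣ ≤ ε → q ≤ p + ε
∣-∣≤⁻ {p} {q} {ε} h = begin
  q                    ≡⟨ split p q ⟩
  p + - (p - q)        ≤⟨ ℚ.+-monoʳ-≤ p (≤∣∣ (- (p - q))) ⟩
  p + ∣ - (p - q) ∣    ≡⟨ cong (λ t → p + t) (ℚ.∣-p∣≡∣p∣ (p - q)) ⟩
  p + ∣ p - q ∣        ≤⟨ ℚ.+-monoʳ-≤ p h ⟩
  p + ε                ∎
  where
  open ℚ.≤-Reasoning
  split : ∀ p q → q ≡ p + - (p - q)
  split = solve-∀ ℚ-ring
  ≤∣∣ : ∀ r → r ≤ ∣ r ∣
  ≤∣∣ r with ℚ.≤-total 0ℚ r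
  ... | inj₁ 0≤r = ℚ.≤-reflexive (sym (ℚ.0≤p⇒∣p∣≡p 0≤r))
  ... | inj₂ r≤0 = ℚ.≤-trans r≤0 (ℚ.0≤∣p∣ r)

shrink : ∀ ε K → .(Positive ε) → .(Positive K) → Σ ℚ λ δ → Positive δ × K * δ ≡ ε
shrink ε K ε>0 K>0 = δ , ℚ.pos*pos⇒pos (1/ K) {{ℚ.1/pos⇒pos K {{K>0}}}} ε {{ε>0}} , eq
  where
  instance
    K≢0 : ℚ.NonZero K
    K≢0 = ℚ.pos⇒nonZero K {{K>0}}
  δ : ℚ
  δ = 1/ K * ε
  eq : K * δ ≡ ε
  eq = trans (sym (ℚ.*-assoc K (1/ K) ε))
         (trans (cong (_* ε) (ℚ.*-inverseʳ K)) (ℚ.*-identityˡ ε))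

*-close : ∀ {a b c d : ℕ → ℚ} {B C δ ε m n N₁ N₂ N₃ N₄} → Positive B → Positive C →
  (B + C) * δ ≡ ε → (N₁ ℕ.⊔ N₂) ℕ.⊔ (N₃ ℕ.⊔ N₄) ℕ.≤ m →
  (N₁ ℕ.⊔ N₂) ℕ.⊔ (N₃ ℕ.⊔ N₄) ℕ.≤ n →
  (∀ {n} → N₁ ℕ.≤ n → ∣ a n ∣ ≤ B) → (∀ {n} → N₂ ℕ.≤ n → ∣ d n ∣ ≤ C) →
  (N₃ ℕ.≤ m → N₃ ℕ.≤ n → ∣ a m - c n ∣ ≤ δ) →
  (N₄ ℕ.≤ m → N₄ ℕ.≤ n → ∣ b m - d n ∣ ≤ δ) →
  ∣ a m * b m - c n * d n ∣ ≤ ε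
*-close {a} {b} {c} {d} {B} {C} {δ} {ε} {m} {n} {N₁} {N₂} {N₃} {N₄} B>0 C>0 eq p q ba bd ac bd′ =
  ℚ.≤-trans
    (∣ab-cd∣≤ {a m} {b m} {c n} {d n} {B} {C} {δ} B>0 C>0
      (ba (ℕ.m⊔n≤o⇒m≤o N₁ N₂ p₁₂)) (bd (ℕ.m⊔n≤o⇒n≤o N₁ N₂ q₁₂))
      (ac (ℕ.m⊔n≤o⇒m≤o N₃ N₄ p₃₄) (ℕ.m⊔n≤o⇒m≤o N₃ N₄ q₃₄))
      (bd′ (ℕ.m⊔n≤o⇒n≤o N₃ N₄ p₃₄) (ℕ.m⊔n≤o⇒n≤o N₃ N₄ q₃₄)))
    (ℚ.≤-reflexive eq)
  where
  p₁₂ = ℕ.m⊔n≤o⇒m≤o (N₁ ℕ.⊔ N₂) (N₃ ℕ.⊔ N₄) p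
  p₃₄ = ℕ.m⊔n≤o⇒n≤o (N₁ ℕ.⊔ N₂) (N₃ ℕ.⊔ N₄) p
  q₁₂ = ℕ.m⊔n≤o⇒m≤o (N₁ ℕ.⊔ N₂) (N₃ ℕ.⊔ N₄) q
  q₃₄ = ℕ.m⊔n≤o⇒n≤o (N₁ ℕ.⊔ N₂) (N₃ ℕ.⊔ N₄) q

infixl 7 _*ℝ_

_*ℝ_ : ℝ → ℝ → ℝ
(x *ℝ y) .seq n = seq x n * seq y n
(x *ℝ y) .cauchy ε {{ε>0}} =
  let B , B>0 , N₁ , bx = cauchy⇒bounded (cauchy x)
      C , C>0 , N₂ , by = cauchy⇒bounded (cauchy y)
      δ , δ>0 , eq      = shrink ε (B + C) ε>0 (ℚ.pos+pos⇒pos B {{B>0}} C {{C>0}})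
      N₃ , cx           = cauchy x δ {{δ>0}}
      N₄ , cy           = cauchy y δ {{δ>0}}
  in (N₁ ℕ.⊔ N₂) ℕ.⊔ (N₃ ℕ.⊔ N₄) , λ p q →
     *-close {seq x} {seq y} {seq x} {seq y} {B} {C} {δ} {ε} {N₁ = N₁} {N₂} {N₃} {N₄}
       B>0 C>0 eq p q bx by cx cy

infixr 8 _^ℝ_

_^ℝ_ : ℝ → ℕ → ℝ
x ^ℝ zero  = 1ℝ
x ^ℝ suc m = x *ℝ x ^ℝ m

∏ : ∀ {n} → Vector ℝ n → ℝ
∏ = foldr _*ℝ_ 1ℝ

------------------------------------------------------------------------
-- Roots of natural numbers

-- The least c with N ≤ c ^ m, for m nonzero.
⌈_^1/_⌉ : ℕ → ℕ → ℕ
⌈ zero  ^1/ m ⌉ = 0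
⌈ suc N ^1/ m ⌉ =
  let c = ⌈ N ^1/ m ⌉ in if N ℕ.<ᵇ c ℕ.^ m then c else suc c

^-monoˡ-< : ∀ m .{{_ : NonZero m}} {a b} → a ℕ.< b → a ℕ.^ m ℕ.< b ℕ.^ m
^-monoˡ-< (suc zero)    {a} {b} a<b rewrite ℕ.*-identityʳ a | ℕ.*-identityʳ b = a<b
^-monoˡ-< (suc (suc m)) a<b = ℕ.*-mono-< a<b (^-monoˡ-< (suc m) a<b)

^-distribʳ-* : ∀ m a b → (a ℕ.* b) ℕ.^ m ≡ a ℕ.^ m ℕ.* b ℕ.^ m
^-distribʳ-* zero    a b = refl
^-distribʳ-* (suc m) a b = trans (cong (a ℕ.* b ℕ.*_) (^-distribʳ-* m a b))
  (interchange a b (a ℕ.^ m) (b ℕ.^ m))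
  where
  interchange : ∀ p q r s → p ℕ.* q ℕ.* (r ℕ.* s) ≡ p ℕ.* r ℕ.* (q ℕ.* s)
  interchange = ℕ-Solver.solve-∀

⌈^1/⌉-upper : ∀ N m .{{_ : NonZero m}} → N ℕ.≤ ⌈ N ^1/ m ⌉ ℕ.^ m
⌈^1/⌉-upper zero    m = ℕ.z≤n
⌈^1/⌉-upper (suc N) m with N ℕ.<ᵇ ⌈ N ^1/ m ⌉ ℕ.^ m | ℕ.<ᵇ-reflects-< N (⌈ N ^1/ m ⌉ ℕ.^ m)
... | true  | ofʸ p = p
... | false | ofⁿ _ = ℕ.≤-<-trans (⌈^1/⌉-upper N m) (^-monoˡ-< m (ℕ.n<1+n ⌈ N ^1/ m ⌉))

⌈^1/⌉-least : ∀ N m {b} → b ℕ.< ⌈ N ^1/ m ⌉ → b ℕ.^ m ℕ.< N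
⌈^1/⌉-least (suc N) m b<c with N ℕ.<ᵇ ⌈ N ^1/ m ⌉ ℕ.^ m | ℕ.<ᵇ-reflects-< N (⌈ N ^1/ m ⌉ ℕ.^ m)
... | true  | ofʸ _ = ℕ.m<n⇒m<1+n (⌈^1/⌉-least N m b<c)
... | false | ofⁿ ¬p = ℕ.≤-<-trans (ℕ.^-monoˡ-≤ m (ℕ.s≤s⁻¹ b<c)) (ℕ.s≤s (ℕ.≮⇒≥ ¬p))

/-mono-≤ : ∀ {a b k l} → a ℕ.* suc l ℕ.≤ b ℕ.* suc k → + a / suc k ≤ + b / suc l
/-mono-≤ {a} {b} {k} {l} p = ℚ.toℚᵘ-cancel-≤ (begin
  ℚ.toℚᵘ (+ a / suc k)   ≃⟨ ℚ.toℚᵘ-fromℚᵘ (ℚᵘ.mkℚᵘ (+ a) k) ⟩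
  ℚᵘ.mkℚᵘ (+ a) k        ≤⟨ ℚᵘ.*≤* (ℤ.≤-trans (ℤ.≤-reflexive (sym (ℤ.pos-* a (suc l))))
                               (ℤ.≤-trans (+≤+ p) (ℤ.≤-reflexive (ℤ.pos-* b (suc k))))) ⟩
  ℚᵘ.mkℚᵘ (+ b) l        ≃⟨ ℚᵘ.≃-sym (ℚ.toℚᵘ-fromℚᵘ (ℚᵘ.mkℚᵘ (+ b) l)) ⟩
  ℚ.toℚᵘ (+ b / suc l)   ∎)
  where open ℚᵘ.≤-Reasoning

ι : ℕ → ℚ
ι n = + n / 1

/-*ι : ∀ a k → (+ a / suc k) * ι (suc k) ≡ ι a
/-*ι a k = ℚ.toℚᵘ-injective (begin
  ℚ.toℚᵘ ((+ a / suc k) * ι (suc k))                  ≈⟨ ℚ.toℚᵘ-homo-* (+ a / suc k) (ι (suc k)) ⟩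
  ℚ.toℚᵘ (+ a / suc k) ℚᵘ.* ℚ.toℚᵘ (ι (suc k))        ≈⟨ ℚᵘ.*-cong (ℚ.toℚᵘ-fromℚᵘ (ℚᵘ.mkℚᵘ (+ a) k)) (ℚ.toℚᵘ-fromℚᵘ (ℚᵘ.mkℚᵘ (+ suc k) 0)) ⟩
  ℚᵘ.mkℚᵘ (+ a) k ℚᵘ.* ℚᵘ.mkℚᵘ (+ suc k) 0            ≈⟨ ℚᵘ.*≡* eq ⟩
  ℚᵘ.mkℚᵘ (+ a) 0                                     ≈⟨ ℚᵘ.≃-sym (ℚ.toℚᵘ-fromℚᵘ (ℚᵘ.mkℚᵘ (+ a) 0)) ⟩
  ℚ.toℚᵘ (ι a)                                        ∎)
  where
  open ℚᵘ.≃-Reasoning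
  eq : + a ℤ.* + suc k ℤ.* + 1 ≡ + a ℤ.* (+ (suc k ℕ.* 1))
  eq = trans (ℤ.*-identityʳ _) (cong (λ t → + a ℤ.* + t) (sym (ℕ.*-identityʳ (suc k))))

ι-* : ∀ a b → ι (a ℕ.* b) ≡ ι a * ι b
ι-* a b = ℚ.toℚᵘ-injective (begin
  ℚ.toℚᵘ (ι (a ℕ.* b))                       ≈⟨ ℚ.toℚᵘ-fromℚᵘ (ℚᵘ.mkℚᵘ (+ (a ℕ.* b)) 0) ⟩
  ℚᵘ.mkℚᵘ (+ (a ℕ.* b)) 0                    ≈⟨ ℚᵘ.*≡* (cong (ℤ._* + 1) (ℤ.pos-* a b)) ⟩
  ℚᵘ.mkℚᵘ (+ a) 0 ℚᵘ.* ℚᵘ.mkℚᵘ (+ b) 0       ≈⟨ ℚᵘ.*-cong (ℚᵘ.≃-sym (ℚ.toℚᵘ-fromℚᵘ (ℚᵘ.mkℚᵘ (+ a) 0))) (ℚᵘ.≃-sym (ℚ.toℚᵘ-fromℚᵘ (ℚᵘ.mkℚᵘ (+ b) 0))) ⟩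
  ℚ.toℚᵘ (ι a) ℚᵘ.* ℚ.toℚᵘ (ι b)             ≈⟨ ℚᵘ.≃-sym (ℚ.toℚᵘ-homo-* (ι a) (ι b)) ⟩
  ℚ.toℚᵘ (ι a * ι b)                         ∎)
  where open ℚᵘ.≃-Reasoning

ι-suc : ∀ a → ι (suc a) ≡ ι a + 1ℚ
ι-suc a = ℚ.toℚᵘ-injective (begin
  ℚ.toℚᵘ (ι (suc a))                  ≈⟨ ℚ.toℚᵘ-fromℚᵘ (ℚᵘ.mkℚᵘ (+ suc a) 0) ⟩
  ℚᵘ.mkℚᵘ (+ suc a) 0                 ≈⟨ ℚᵘ.*≡* (cong (λ t → + t ℤ.* + 1) (trans (ℕ.+-comm 1 a) (cong (ℕ._+ 1) (sym (ℕ.*-identityʳ a))))) ⟩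
  ℚᵘ.mkℚᵘ (+ (a ℕ.* 1 ℕ.+ 1)) 0       ≈⟨ ℚᵘ.≃-reflexive (cong (λ t → ℚᵘ.mkℚᵘ (t ℤ.+ + 1) 0) (ℤ.pos-* a 1)) ⟩
  ℚᵘ.mkℚᵘ (+ a) 0 ℚᵘ.+ ℚᵘ.1ℚᵘ         ≈⟨ ℚᵘ.+-cong (ℚᵘ.≃-sym (ℚ.toℚᵘ-fromℚᵘ (ℚᵘ.mkℚᵘ (+ a) 0))) (ℚᵘ.≃-refl {ℚᵘ.1ℚᵘ}) ⟩
  ℚ.toℚᵘ (ι a) ℚᵘ.+ ℚ.toℚᵘ 1ℚ         ≈⟨ ℚᵘ.≃-sym (ℚ.toℚᵘ-homo-+ (ι a) 1ℚ) ⟩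
  ℚ.toℚᵘ (ι a + 1ℚ)                   ∎)
  where open ℚᵘ.≃-Reasoning

ι-mono-≤ : ∀ {a b} → a ℕ.≤ b → ι a ≤ ι b
ι-mono-≤ {a} {b} p = /-mono-≤ {a} {b} {0} {0} (ℕ.*-monoˡ-≤ 1 p)

ι-pos : ∀ n → Positive (ι (suc n))
ι-pos n = ℚ.normalize-pos (suc n) 1

archimedean : ∀ ε → .{{Positive ε}} → ∃ λ N → ∀ {n} → N ℕ.≤ n → + 1 / suc n ≤ ε
archimedean ε@(ℚ.mkℚ (+ suc a) d _) = d , λ {n} d≤n → begin
  + 1 / suc n        ≤⟨ /-mono-≤ {1} {suc a} {n} {d} (ℕ.*-mono-≤ (ℕ.s≤s (ℕ.z≤n {a})) (ℕ.s≤s d≤n)) ⟩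
  + suc a / suc d    ≡⟨ ℚ.↥p/↧p≡p ε ⟩
  ε                  ∎
  where open ℚ.≤-Reasoning

module Root (x m : ℕ) .{{_ : NonZero m}} where

  num : ℕ → ℕ
  num n = ⌈ x ℕ.* suc n ℕ.^ m ^1/ m ⌉

  upper lower : ℕ → ℚ
  upper n = + num n / suc n
  lower n = + ℕ.pred (num n) / suc n

  num-lower : ∀ n → ℕ.pred (num n) ℕ.^ m ℕ.≤ x ℕ.* suc n ℕ.^ m
  num-lower n with num n in eq
  ... | zero  = subst (ℕ._≤ x ℕ.* suc n ℕ.^ m) (sym (0^ m)) ℕ.z≤n
    where
    0^ : ∀ m .{{_ : NonZero m}} → 0 ℕ.^ m ≡ 0
    0^ (suc m) = refl
  ... | suc b = ℕ.<⇒≤ (⌈^1/⌉-least _ m (ℕ.≤-reflexive (sym eq)))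

  lower≤upper : ∀ p q → lower p ≤ upper q
  lower≤upper p q = /-mono-≤ {b} {c} {p} {q} (ℕ.≮⇒≥ λ lt → ℕ.<⇒≱ (^-monoˡ-< m lt) (begin
    (b ℕ.* suc q) ℕ.^ m                     ≡⟨ ^-distribʳ-* m b (suc q) ⟩
    b ℕ.^ m ℕ.* suc q ℕ.^ m                 ≤⟨ ℕ.*-monoˡ-≤ (suc q ℕ.^ m) (num-lower p) ⟩
    x ℕ.* suc p ℕ.^ m ℕ.* suc q ℕ.^ m       ≡⟨ swap x (suc p ℕ.^ m) (suc q ℕ.^ m) ⟩
    x ℕ.* suc q ℕ.^ m ℕ.* suc p ℕ.^ m       ≤⟨ ℕ.*-monoˡ-≤ (suc p ℕ.^ m) (⌈^1/⌉-upper (x ℕ.* suc q ℕ.^ m) m) ⟩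
    c ℕ.^ m ℕ.* suc p ℕ.^ m                 ≡⟨ sym (^-distribʳ-* m c (suc p)) ⟩
    (c ℕ.* suc p) ℕ.^ m                     ∎))
    where
    open ℕ.≤-Reasoning
    b c : ℕ
    b = ℕ.pred (num p)
    c = num q
    swap : ∀ u v w → u ℕ.* v ℕ.* w ≡ u ℕ.* w ℕ.* v
    swap = ℕ-Solver.solve-∀

  upper≤lower+ : ∀ n → upper n ≤ lower n + + 1 / suc n
  upper≤lower+ n = ℚ.*-cancelʳ-≤-pos (ι (suc n)) {{ι-pos n}} (begin
    upper n * ι (suc n)                              ≡⟨ /-*ι (num n) n ⟩
    ι (num n)                                        ≤⟨ ι-mono-≤ (≤-suc-pred (num n)) ⟩
    ι (suc (ℕ.pred (num n)))                         ≡⟨ ι-suc (ℕ.pred (num n)) ⟩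
    ι (ℕ.pred (num n)) + 1ℚ                          ≡⟨ sym (cong₂ _+_ (/-*ι (ℕ.pred (num n)) n) (/-*ι 1 n)) ⟩
    lower n * ι (suc n) + (+ 1 / suc n) * ι (suc n)  ≡⟨ sym (ℚ.*-distribʳ-+ (ι (suc n)) (lower n) (+ 1 / suc n)) ⟩
    (lower n + + 1 / suc n) * ι (suc n)              ∎)
    where
    open ℚ.≤-Reasoning
    ≤-suc-pred : ∀ k → k ℕ.≤ suc (ℕ.pred k)
    ≤-suc-pred zero    = ℕ.z≤n
    ≤-suc-pred (suc k) = ℕ.≤-refl

  upper-cauchy : Cauchy upper
  upper-cauchy ε = N , λ {p} {q} N≤p N≤q → ∣-∣≤ (close p q N≤p) (close q p N≤q)
    where
    N     = proj₁ (archimedean ε)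
    small = proj₂ (archimedean ε)
    close : ∀ p q → N ℕ.≤ p → upper p ≤ upper q + ε
    close p q N≤p =
      ℚ.≤-trans (upper≤lower+ p) (ℚ.+-mono-≤ (lower≤upper p q) (small {p} N≤p))

  root : ℝ
  root = mkℝ upper upper-cauchy

-- x ^[1/ m ] is the nonnegative m-th root of x for m nonzero (see ^[1/]-nonneg
-- and ^[1/]-^ℝ below), and 0 for m = 0.
infix 9 _^[1/_]

_^[1/_] : ℕ → ℕ → ℝ
x ^[1/ zero      ] = 0ℝ
x ^[1/ m@(suc _) ] = Root.root x m

^[1/]-nonneg : ∀ x m → 0ℝ ≤ℝ x ^[1/ m ]
^[1/]-nonneg x zero      ε {{ε>0}} = 0 , λ _ →
  subst (0ℚ ≤_) (sym (ℚ.+-identityˡ ε)) (ℚ.<⇒≤ (ℚ.positive⁻¹ ε {{ε>0}}))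
^[1/]-nonneg x m@(suc _) ε {{ε>0}} = 0 , λ {n} _ →
  ℚ.nonNegative⁻¹ _ {{ℚ.nonNeg+nonNeg⇒nonNeg
    (Root.upper x m n) {{ℚ.normalize-nonNeg (Root.num x m n) (suc n)}}
    ε {{ℚ.pos⇒nonNeg ε {{ε>0}}}}}}

^[1/]-^ℝ : ∀ x m .{{_ : NonZero m}} → (x ^[1/ m ]) ^ℝ m ≃ℝ fromℕ x
^[1/]-^ℝ x m@(suc _) = below , above
  where
  open Root x m
  open ℚ.≤-Reasoning

  infixr 8 _^_
  _^_ : ℚ → ℕ → ℚ
  p ^ zero  = 1ℚ
  p ^ suc k = p * p ^ k

  seq-^ : ∀ k n → seq (root ^ℝ k) n ≡ upper n ^ k
  seq-^ zero    n = refl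
  seq-^ (suc k) n = cong (upper n *_) (seq-^ k n)

  frac-^ : ∀ a n k → (+ a / suc n) ^ k * ι (suc n ℕ.^ k) ≡ ι (a ℕ.^ k)
  frac-^ a n zero    = refl
  frac-^ a n (suc k) = begin-equality
    p * p ^ k * ι (suc n ℕ.* suc n ℕ.^ k)          ≡⟨ cong (p * p ^ k *_) (ι-* (suc n) (suc n ℕ.^ k)) ⟩
    p * p ^ k * (ι (suc n) * ι (suc n ℕ.^ k))      ≡⟨ interchange p (p ^ k) (ι (suc n)) (ι (suc n ℕ.^ k)) ⟩
    p * ι (suc n) * (p ^ k * ι (suc n ℕ.^ k))      ≡⟨ cong₂ _*_ (/-*ι a n) (frac-^ a n k) ⟩
    ι a * ι (a ℕ.^ k)                              ≡⟨ sym (ι-* a (a ℕ.^ k)) ⟩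
    ι (a ℕ.* a ℕ.^ k)                              ∎
    where
    p : ℚ
    p = + a / suc n
    interchange : ∀ p q r s → p * q * (r * s) ≡ p * r * (q * s)
    interchange = solve-∀ ℚ-ring

  pos : ∀ n → Positive (ι (suc n ℕ.^ m))
  pos n = ℚ.normalize-pos (suc n ℕ.^ m) 1 {{_}} {{ℕ.m^n≢0 (suc n) m}}

  x≤upper^m : ∀ n → ι x ≤ upper n ^ m
  x≤upper^m n = ℚ.*-cancelʳ-≤-pos (ι (suc n ℕ.^ m)) {{pos n}} (begin
    ι x * ι (suc n ℕ.^ m)          ≡⟨ sym (ι-* x (suc n ℕ.^ m)) ⟩
    ι (x ℕ.* suc n ℕ.^ m)          ≤⟨ ι-mono-≤ (⌈^1/⌉-upper (x ℕ.* suc n ℕ.^ m) m) ⟩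
    ι (num n ℕ.^ m)                ≡⟨ sym (frac-^ (num n) n m) ⟩
    upper n ^ m * ι (suc n ℕ.^ m)  ∎)

  lower^m≤x : ∀ n → lower n ^ m ≤ ι x
  lower^m≤x n = ℚ.*-cancelʳ-≤-pos (ι (suc n ℕ.^ m)) {{pos n}} (begin
    lower n ^ m * ι (suc n ℕ.^ m)  ≡⟨ frac-^ (ℕ.pred (num n)) n m ⟩
    ι (ℕ.pred (num n) ℕ.^ m)       ≤⟨ ι-mono-≤ (num-lower n) ⟩
    ι (x ℕ.* suc n ℕ.^ m)          ≡⟨ ι-* x (suc n ℕ.^ m) ⟩
    ι x * ι (suc n ℕ.^ m)          ∎)

  ∣lower∣≤∣upper∣ : ∀ n → ∣ lower n ∣ ≤ ∣ upper n ∣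
  ∣lower∣≤∣upper∣ n = begin
    ∣ lower n ∣  ≡⟨ ℚ.0≤p⇒∣p∣≡p (ℚ.nonNegative⁻¹ _ {{ℚ.normalize-nonNeg (ℕ.pred (num n)) (suc n)}}) ⟩
    lower n      ≤⟨ lower≤upper n n ⟩
    upper n      ≡⟨ sym (ℚ.0≤p⇒∣p∣≡p (ℚ.nonNegative⁻¹ _ {{ℚ.normalize-nonNeg (num n) (suc n)}})) ⟩
    ∣ upper n ∣  ∎

  lower-close : ∀ ε → .{{Positive ε}} →
    ∃ λ N → ∀ {n} → N ℕ.≤ n → ∣ lower n - upper n ∣ ≤ ε
  lower-close ε {{ε>0}} = let N , small = archimedean ε in N , λ {n} N≤n → ∣-∣≤
    (begin
      lower n       ≤⟨ lower≤upper n n ⟩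
      upper n       ≡⟨ sym (ℚ.+-identityʳ (upper n)) ⟩
      upper n + 0ℚ  ≤⟨ ℚ.+-monoʳ-≤ (upper n) (ℚ.<⇒≤ (ℚ.positive⁻¹ ε {{ε>0}})) ⟩
      upper n + ε   ∎)
    (ℚ.≤-trans (upper≤lower+ n) (ℚ.+-monoʳ-≤ (lower n) (small N≤n)))

  close : ∀ k ε → .{{Positive ε}} →
    ∃ λ N → ∀ {n} → N ℕ.≤ n → ∣ lower n ^ k - seq (root ^ℝ k) n ∣ ≤ ε
  close zero    ε {{ε>0}} = 0 , λ _ → ℚ.<⇒≤ (ℚ.positive⁻¹ ε {{ε>0}})
  close (suc k) ε {{ε>0}} =
    let B , B>0 , N₁ , bu = cauchy⇒bounded (cauchy root)
        C , C>0 , N₂ , bp = cauchy⇒bounded (cauchy (root ^ℝ k))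
        δ , δ>0 , eq      = shrink ε (B + C) ε>0 (ℚ.pos+pos⇒pos B {{B>0}} C {{C>0}})
        N₃ , cl           = lower-close δ {{δ>0}}
        N₄ , ih           = close k δ {{δ>0}}
    in (N₁ ℕ.⊔ N₂) ℕ.⊔ (N₃ ℕ.⊔ N₄) , λ p →
       *-close {lower} {λ n → lower n ^ k} {upper} {seq (root ^ℝ k)} {B} {C} {δ} {ε}
         {N₁ = N₁} {N₂} {N₃} {N₄} B>0 C>0 eq p p
         (λ {n} q → ℚ.≤-trans (∣lower∣≤∣upper∣ n) (bu q)) bp
         (λ q _ → cl q) (λ q _ → ih q)

  below : root ^ℝ m ≤ℝ fromℕ x
  below ε = let N , h = close m ε in N , λ {n} N≤n →
    ℚ.≤-trans (∣-∣≤⁻ {lower n ^ m} {seq (root ^ℝ m) n} (h N≤n)) (ℚ.+-monoˡ-≤ ε (lower^m≤x n))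

  above : fromℕ x ≤ℝ root ^ℝ m
  above ε {{ε>0}} = 0 , λ {n} _ → begin
    ι x                      ≤⟨ x≤upper^m n ⟩
    upper n ^ m              ≡⟨ sym (seq-^ m n) ⟩
    seq (root ^ℝ m) n        ≡⟨ sym (ℚ.+-identityʳ _) ⟩
    seq (root ^ℝ m) n + 0ℚ   ≤⟨ ℚ.+-monoʳ-≤ (seq (root ^ℝ m) n) (ℚ.<⇒≤ (ℚ.positive⁻¹ ε {{ε>0}})) ⟩
    seq (root ^ℝ m) n + ε    ∎

------------------------------------------------------------------------
-- Perfect matchings and hafnians

Edge : ℕ → Set
Edge n = Fin n × Fin n

-- Each two-element subset {i , j} is listed once, as (i , j) with i < j.
pairs : ∀ n → List (Edge n)
pairs n = filter (λ (i , j) → i Fin.<? j) (cartesianProduct (allFin n) (allFin n))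

-- All subsets of a duplicate-free list, each listed once.
sublists : ∀ {A : Set} → List A → List (List A)
sublists []       = [] ∷ []
sublists (x ∷ xs) = map (x ∷_) (sublists xs) ++ sublists xs

module _ {n : ℕ} where

  Incident : Fin n → Edge n → Set
  Incident v (i , j) = v ≡ i ⊎ v ≡ j

  incident? : ∀ v → Decidable₁ (Incident v)
  incident? v (i , j) = (v Fin.≟ i) ⊎-dec (v Fin.≟ j)

  -- Each vertex lies in exactly one edge of M.
  IsPerfect : List (Edge n) → Set
  IsPerfect M = ∀ v → length (filter (incident? v) M) ≡ 1

  isPerfect? : Decidable₁ IsPerfect
  isPerfect? M = Fin.all? λ v → length (filter (incident? v) M) ℕ.≟ 1

  -- The perfect matchings contained in a given duplicate-free list of edges.
  perfectMatchings : List (Edge n) → List (List (Edge n))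
  perfectMatchings E = filter isPerfect? (sublists E)

record Graph (n : ℕ) : Set₁ where
  field
    Adj        : Rel (Fin n) 0ℓ
    adj?       : Decidable Adj
    adj-sym    : Symmetric Adj
    adj-irrefl : Irreflexive _≡_ Adj

  edges : List (Edge n)
  edges = filter (λ (i , j) → adj? i j) (pairs n)

  deg : Fin n → ℕ
  deg v = length (filter (adj? v) (allFin n))

  perfmat : ℕ
  perfmat = length (perfectMatchings edges)

-- Natural-number entries suffice for 0/1 matrices and keep the row sums in ℕ,
-- where their factorials are taken.
Matrix : ℕ → Set
Matrix n = Fin n → Fin n → ℕ

module _ {n : ℕ} (A : Matrix n) where

  hafn : ℕ
  hafn = sum (map (λ M → product (map (λ (i , j) → A i j) M)) (perfectMatchings (pairs n)))

  rowSum : Fin n → ℕ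
  rowSum i = sum (map (A i) (allFin n))

  Is01 : Set
  Is01 = ∀ i j → A i j ≡ 0 ⊎ A i j ≡ 1

  IsSymmetric : Set
  IsSymmetric = ∀ i j → A i j ≡ A j i

  ZeroDiagonal : Set
  ZeroDiagonal = ∀ i → A i i ≡ 0

{-# OPTIONS --safe #-}
module Submission where

-- Write f(S) for the number of perfect matchings of G[S], F = f(V), and c(v,w) for the number
-- of perfect matchings using the edge vw, so c(v,w) = f(V ∖ v ∖ w) on edges, and every row of the
-- symmetric matrix c sums to F.  As in Schrijver's proof of Brégman's theorem, convexity of x log x
-- gives F^F ≤ (deg v)^F ∏_w c(v,w)^c(v,w) for each v, and each c(v,w) is bounded by induction by
-- ∏_u g(deg u - a_uv - a_uw)^½, where g(d) = (d!)^(1/d).  Log-concavity of g makes this bound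
-- log-linear in a_uv + a_uw, so in the product over all (v,w) the exponent belonging to a vertex u
-- depends on the marginals of c only, and (deg u) g(deg u - 1)^(deg u - 1) = g(deg u)^(deg u)
-- yields F² ≤ ∏_u g(deg u).
--
-- Everything is done in ℕ with L-th powers of g, where L is a common multiple of the degrees; the
-- real inequality then holds between the terms of the defining Cauchy sequences.

open import Data.Bool.Base using (Bool; true; false; not; _∧_)
open import Data.Bool.Properties using (∧-zeroʳ)
open import Data.Fin.Base as Fin using (Fin; zero; suc)
import Data.Fin.Properties as Fin
open import Data.List.Base
  using (List; []; _∷_; _++_; map; filter; length; allFin; tabulate; cartesianProduct)
open import Data.List.Properties
  using (filter-++; filter-≐; filter-none; filter-accept; filter-reject; map-++; map-∘; map-cong)
open import Data.List.Relation.Unary.All as All using (All; []; _∷_)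
open import Data.List.Relation.Unary.All.Properties using (all-filter)
open import Data.Nat.Base
open import Data.Nat.Divisibility using (∣-trans; m∣m*n; m≤n⇒m!∣n!)
open import Data.Nat.DivMod using (m/n*n≡m)
open import Data.Nat.ListAction using (product) renaming (sum to listSum)
open import Data.Nat.ListAction.Properties using (sum-++)
open import Data.Nat.Properties hiding (^-monoˡ-<)
open import Data.Nat.Tactic.RingSolver using (solve-∀)
open import Data.Product.Base using (∃; _×_; _,_; proj₁; proj₂)
import Data.Rational.Base as ℚ
import Data.Rational.Properties as ℚ
open import Data.Sum.Base using (_⊎_; inj₁; inj₂)
open import Data.Vec.Functional using (Vector; head; tail)
open import Defs
open import Function.Base using (_∘_; id)
open import Function.Bundles using (mk⇔)
open import Relation.Binary.Definitions using (tri<; tri≈; tri>)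
open import Relation.Binary.PropositionalEquality
  using (_≡_; _≢_; _≗_; refl; sym; trans; cong; cong₂; subst; subst₂; module ≡-Reasoning)
open import Relation.Nullary.Decidable using (yes; no; does; dec-true; dec-false; does-⇔)
open import Relation.Nullary.Negation using (¬_; contradiction)
open import Relation.Unary using () renaming (Decidable to Decidable₁)
import Tactic.RingSolver as Ring

open import Algebra.Properties.Semiring.Sum +-*-semiring
  using (sum; sum-cong-≗; ∑-distrib-+; ∑-comm; *-distribˡ-sum; *-distribʳ-sum; sum-replicate-zero)
open import Algebra.Properties.CommutativeMonoid.Sum *-1-commutativeMonoid using ()
  renaming (sum to prod; sum-cong-≗ to prod-cong-≗; ∑-distrib-+ to ∏-distrib-*; ∑-comm to ∏-comm)

-- Convexity of x log x and log-concavity of (d !) ^ (1 / d)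

-- In Brégman's setting, deleting a row and a column lowers every other row sum by at most 1. Here
-- deleting both ends of vw can lower deg u by 2, and the share of c lying on pairs inside the
-- neighbourhood of u is not determined by the row sums of c. Log-concavity removes this obstacle:
-- it lets a drop of 2 be charged as two separate drops of 1, one for v and one for w. With F
-- matchings on m vertices and d = deg u, the product of all c(v,w)^(2c(v,w)) is then at most the
-- product over u of g(d)^((m-2)F) (g(d-1)/g(d))^(2(d-1)F). The squared entropy bounds supply d^(2F)
-- for each u, and everything collapses to g(d)^(mF). Quotients such as g(d-1)/g(d) do not exist in
-- ℕ, so denominators are moved across each inequality and cancelled at the end. Since g(0) = 0,
-- that cancellation needs its own argument.

^-cancelˡ-≤ : ∀ k .{{_ : NonZero k}} {x y} → x ^ k ≤ y ^ k → x ≤ y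
^-cancelˡ-≤ k p = ≮⇒≥ λ y<x → <⇒≱ (^-monoˡ-< k y<x) p

n^n≢0 : ∀ n → NonZero (n ^ n)
n^n≢0 zero    = _
n^n≢0 (suc n) = m^n≢0 (suc n) (suc n)

2yz≤y²+z² : ∀ y z → 2 * (y * z) ≤ y * y + z * z
2yz≤y²+z² y z with ≤-total y z
... | inj₁ y≤z with o , refl ← m≤n⇒∃[o]m+o≡n y≤z =
  subst (2 * (y * (y + o)) ≤_) (expand y o) (m≤m+n _ (o * o))
  where
  expand : ∀ y o → 2 * (y * (y + o)) + o * o ≡ y * y + (y + o) * (y + o)
  expand = solve-∀
... | inj₂ z≤y with o , refl ← m≤n⇒∃[o]m+o≡n z≤y =
  subst (2 * ((z + o) * z) ≤_) (expand z o) (m≤m+n _ (o * o))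
  where
  expand : ∀ z o → 2 * ((z + o) * z) + o * o ≡ (z + o) * (z + o) + z * z
  expand = solve-∀

-- Bernoulli's inequality for the ratio of `y` to `z`, made homogeneous. Multiplying case `n` by `y`
-- and adding `suc n * z ^ n` times `2yz≤y²+z²` gives the next case plus terms common to both sides,
-- which are cancelled.
bernoulli : ∀ n y z → suc n * (y * z ^ n) ≤ y ^ suc n + n * z ^ suc n
bernoulli zero    y z = ≤-refl
bernoulli (suc n) y z = +-cancelˡ-≤ (suc n * (y * y * z ^ n) + n * (y * z * z ^ n)) _ _ (begin
  suc n * (y * y * Z) + n * (y * z * Z) + (2 + n) * (y * (z * Z))  ≡⟨ lhs n y z Z ⟩
  y * (suc n * (y * Z)) + suc n * Z * (2 * (y * z))                ≤⟨ +-mono-≤ (*-monoʳ-≤ y (bernoulli n y z))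
      (*-monoʳ-≤ (suc n * Z) (2yz≤y²+z² y z)) ⟩
  y * (Y + n * (z * Z)) + suc n * Z * (y * y + z * z)              ≡⟨ rhs n y z Z Y ⟩
  suc n * (y * y * Z) + n * (y * z * Z) + (y * Y + suc n * (z * (z * Z))) ∎)
  where
  open ≤-Reasoning
  Z Y : ℕ
  Z = z ^ n
  Y = y ^ suc n
  lhs : ∀ n y z Z → suc n * (y * y * Z) + n * (y * z * Z) + (2 + n) * (y * (z * Z)) ≡
    y * (suc n * (y * Z)) + suc n * Z * (2 * (y * z))
  lhs = solve-∀
  rhs : ∀ n y z Z Y → y * (Y + n * (z * Z)) + suc n * Z * (y * y + z * z) ≡
    suc n * (y * y * Z) + n * (y * z * Z) + (y * Y + suc n * (z * (z * Z)))
  rhs = solve-∀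

-- Bernoulli's inequality at y = n (s + x), z = (n + 1) s.
amgm-step : ∀ n s x → suc n ^ suc n * (s ^ n * x) ≤ n ^ n * (s + x) ^ suc n
amgm-step zero      s x = ≤-trans (≤-reflexive (lhs x)) (≤-trans (m≤n+m x s) (≤-reflexive (rhs (s + x))))
  where
  lhs : ∀ x → 1 * (1 * x) ≡ x
  lhs = solve-∀
  rhs : ∀ x → x ≡ 1 * (x * 1)
  rhs = solve-∀
amgm-step n@(suc _) s x = *-cancelˡ-≤ n (+-cancelˡ-≤ (n * (suc n * s * Z)) _ _ (begin
  n * (suc n * s * Z) + n * (suc n ^ suc n * (s ^ n * x))  ≡⟨ lhs n s x Z (suc n ^ n) (s ^ n)
      (^-distribʳ-* n (suc n) s) ⟩
  suc n * (n * (s + x) * Z)                                ≤⟨ bernoulli n (n * (s + x)) (suc n * s) ⟩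
  (n * (s + x)) ^ suc n + n * (suc n * s * Z)              ≡⟨ cong (_+ n * (suc n * s * Z))
      (^-distribʳ-* (suc n) n (s + x)) ⟩
  n * n ^ n * (s + x) ^ suc n + n * (suc n * s * Z)        ≡⟨ rhs n (n * (suc n * s * Z)) (n ^ n)
      ((s + x) ^ suc n) ⟩
  n * (suc n * s * Z) + n * (n ^ n * (s + x) ^ suc n)      ∎))
  where
  open ≤-Reasoning
  Z : ℕ
  Z = (suc n * s) ^ n
  lhs : ∀ n s x Z P Q → Z ≡ P * Q →
    n * (suc n * s * Z) + n * (suc n * P * (Q * x)) ≡ suc n * (n * (s + x) * Z)
  lhs n s x _ P Q refl = go n s x P Q
    where
    go : ∀ n s x P Q → n * (suc n * s * (P * Q)) + n * (suc n * P * (Q * x)) ≡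
      suc n * (n * (s + x) * (P * Q))
    go = solve-∀
  rhs : ∀ n U P S → n * P * S + U ≡ U + n * (P * S)
  rhs = solve-∀

-- For `a` > 0 this is AM-GM for `a` copies of `s / a` and `b` copies of `y`, with denominators
-- cleared. The induction adjoins one copy of `y` at a time by `amgm-step`, with running total
-- `s + b * y`.
amgm : ∀ a b s y → (a + b) ^ (a + b) * (s ^ a * y ^ b) ≤ a ^ a * (s + b * y) ^ (a + b)
amgm a zero    s y rewrite +-identityʳ a | +-identityʳ s | *-identityʳ (s ^ a) = ≤-refl
amgm a (suc b) s y rewrite +-suc a b = *-cancelˡ-≤ (n ^ n) {{n^n≢0 n}} (begin
  n ^ n * (suc n ^ suc n * (s ^ a * (y * y ^ b)))  ≡⟨ lhs (n ^ n) (suc n ^ suc n) (s ^ a) y (y ^ b) ⟩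
  suc n ^ suc n * (n ^ n * (s ^ a * y ^ b) * y)    ≤⟨ *-monoʳ-≤ (suc n ^ suc n) (*-monoˡ-≤ y (amgm a b s y)) ⟩
  suc n ^ suc n * (a ^ a * t ^ n * y)              ≡⟨ mid (suc n ^ suc n) (a ^ a) (t ^ n) y ⟩
  a ^ a * (suc n ^ suc n * (t ^ n * y))            ≤⟨ *-monoʳ-≤ (a ^ a) (amgm-step n t y) ⟩
  a ^ a * (n ^ n * (t + y) ^ suc n)                ≡⟨ cong (λ u → a ^ a * (n ^ n * u ^ suc n)) (shift s b y) ⟩
  a ^ a * (n ^ n * (s + suc b * y) ^ suc n)        ≡⟨ rhs (a ^ a) (n ^ n) ((s + suc b * y) ^ suc n) ⟩
  n ^ n * (a ^ a * (s + suc b * y) ^ suc n)        ∎)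
  where
  open ≤-Reasoning
  n t : ℕ
  n = a + b
  t = s + b * y
  lhs : ∀ p q r y u → p * (q * (r * (y * u))) ≡ q * (p * (r * u) * y)
  lhs = solve-∀
  mid : ∀ p q r y → p * (q * r * y) ≡ q * (p * (r * y))
  mid = solve-∀
  rhs : ∀ p q r → p * (q * r) ≡ q * (p * r)
  rhs = solve-∀
  shift : ∀ s b y → s + b * y + y ≡ s + suc b * y
  shift = solve-∀

-- Weighted AM-GM for the values b p / a (with weight a) and r (with weight b).
log-sum₂ : ∀ a b p r →
  p ^ a * r ^ b * (a + b) ^ (a + b) ≤ a ^ a * b ^ b * (p + r) ^ (a + b)
log-sum₂ a zero    p r rewrite +-identityʳ a | *-identityʳ (p ^ a) | *-identityʳ (a ^ a)
  | *-comm (p ^ a) (a ^ a) = *-monoʳ-≤ (a ^ a) (^-monoˡ-≤ a (m≤m+n p r))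
log-sum₂ a b@(suc _) p r = *-cancelˡ-≤ (b ^ a) {{m^n≢0 b a}} (begin
  b ^ a * (p ^ a * r ^ b * (a + b) ^ (a + b))    ≡⟨ lhs (b ^ a) (p ^ a) (r ^ b) ((a + b) ^ (a + b)) ⟩
  (a + b) ^ (a + b) * (b ^ a * p ^ a * r ^ b)    ≡⟨ cong (λ u → (a + b) ^ (a + b) * (u * r ^ b))
      (^-distribʳ-* a b p) ⟨
  (a + b) ^ (a + b) * ((b * p) ^ a * r ^ b)      ≤⟨ amgm a b (b * p) r ⟩
  a ^ a * (b * p + b * r) ^ (a + b)              ≡⟨ cong (λ u → a ^ a * u ^ (a + b)) (*-distribˡ-+ b p r) ⟨
  a ^ a * (b * (p + r)) ^ (a + b)                ≡⟨ cong (a ^ a *_) (^-distribʳ-* (a + b) b (p + r)) ⟩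
  a ^ a * (b ^ (a + b) * (p + r) ^ (a + b))      ≡⟨ cong (λ u → a ^ a * (u * (p + r) ^ (a + b)))
      (^-distribˡ-+-* b a b) ⟩
  a ^ a * (b ^ a * b ^ b * (p + r) ^ (a + b))    ≡⟨ rhs (a ^ a) (b ^ a) (b ^ b) ((p + r) ^ (a + b)) ⟩
  b ^ a * (a ^ a * b ^ b * (p + r) ^ (a + b))    ∎)
  where
  open ≤-Reasoning
  lhs : ∀ p q r s → p * (q * r * s) ≡ s * (p * q * r)
  lhs = solve-∀
  rhs : ∀ p q r s → p * (q * r * s) ≡ q * (p * r * s)
  rhs = solve-∀

-- The exponentiated form of ∑ q log (q / p) ≥ Q log (Q / P), where P and Q are the sums of `p` and
-- `q`. Entries with `q i` = 0 contribute nothing because 0 ^ 0 = 1. The tail is first merged into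
-- the single pair (P , Q), and `log-sum₂` then joins the head to it.
log-sum : ∀ {n} (p q : Vector ℕ n) →
  prod (λ i → p i ^ q i) * sum q ^ sum q ≤ prod (λ i → q i ^ q i) * sum p ^ sum q
log-sum {zero}  p q = ≤-refl
log-sum {suc n} p q = *-cancelˡ-≤ (Q ^ Q) {{n^n≢0 Q}} (begin
  Q ^ Q * (p₀ ^ q₀ * Π * (q₀ + Q) ^ (q₀ + Q))      ≡⟨ lhs (Q ^ Q) (p₀ ^ q₀) Π ((q₀ + Q) ^ (q₀ + Q)) ⟩
  Π * Q ^ Q * (p₀ ^ q₀ * (q₀ + Q) ^ (q₀ + Q))      ≤⟨ *-monoˡ-≤ _ (log-sum (tail p) (tail q)) ⟩
  Πq * P ^ Q * (p₀ ^ q₀ * (q₀ + Q) ^ (q₀ + Q))     ≡⟨ mid Πq (P ^ Q) (p₀ ^ q₀) ((q₀ + Q) ^ (q₀ + Q)) ⟩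
  Πq * (p₀ ^ q₀ * P ^ Q * (q₀ + Q) ^ (q₀ + Q))     ≤⟨ *-monoʳ-≤ Πq (log-sum₂ q₀ Q p₀ P) ⟩
  Πq * (q₀ ^ q₀ * Q ^ Q * (p₀ + P) ^ (q₀ + Q))     ≡⟨ rhs Πq (q₀ ^ q₀) (Q ^ Q) ((p₀ + P) ^ (q₀ + Q)) ⟩
  Q ^ Q * (q₀ ^ q₀ * Πq * (p₀ + P) ^ (q₀ + Q))     ∎)
  where
  open ≤-Reasoning
  p₀ q₀ P Q Π Πq : ℕ
  p₀ = head p
  q₀ = head q
  P = sum (tail p)
  Q = sum (tail q)
  Π = prod (λ i → tail p i ^ tail q i)
  Πq = prod (λ i → tail q i ^ tail q i)
  lhs : ∀ a b c d → a * (b * c * d) ≡ c * a * (b * d)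
  lhs = solve-∀
  mid : ∀ a b c d → a * b * (c * d) ≡ a * (c * b * d)
  mid = solve-∀
  rhs : ∀ a b c d → a * (b * c * d) ≡ c * (b * a * d)
  rhs = solve-∀

-- For m ≥ 2 this is g(m-1) g(m+1) ≤ g(m)² with roots cleared, powers of (m-1)! cancelled and both
-- sides multiplied by m². Passing from m to m+1 costs exactly the factor (m (m+2) / (m+1)²) ^ (m
-- (m+1)), which is at most 1.
m!²[1+m]^[m[m-1]]≤m^[m[1+m]] : ∀ k → let m = suc k in
  m ! * m ! * suc m ^ (m * k) ≤ m ^ (m * suc m)
m!²[1+m]^[m[m-1]]≤m^[m[1+m]] zero    = ≤-refl
m!²[1+m]^[m[m-1]]≤m^[m[1+m]] (suc k) = *-cancelˡ-≤ (suc m ^ (m * k)) {{m^n≢0 (suc m) (m * k)}} (begin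
  suc m ^ (m * k) * (suc m * m ! * (suc m * m !) * (2 + m) ^ (suc m * m))
    ≡⟨ lhs (suc m ^ (m * k)) (suc m) (m !) ((2 + m) ^ (suc m * m)) ⟩
  m ! * m ! * suc m ^ (m * k) * (suc m * suc m * (2 + m) ^ (suc m * m))
    ≤⟨ *-monoˡ-≤ _ (m!²[1+m]^[m[m-1]]≤m^[m[1+m]] k) ⟩
  m ^ (m * suc m) * (suc m * suc m * (2 + m) ^ (suc m * m))
    ≡⟨ cong (λ e → m ^ e * (suc m * suc m * (2 + m) ^ (suc m * m))) (*-comm m (suc m)) ⟩
  m ^ (suc m * m) * (suc m * suc m * (2 + m) ^ (suc m * m))
    ≡⟨ swap (m ^ (suc m * m)) (suc m * suc m) ((2 + m) ^ (suc m * m)) ⟩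
  suc m * suc m * (m ^ (suc m * m) * (2 + m) ^ (suc m * m))
    ≡⟨ cong (suc m * suc m *_) (^-distribʳ-* (suc m * m) m (2 + m)) ⟨
  suc m * suc m * (m * (2 + m)) ^ (suc m * m)
    ≤⟨ *-monoʳ-≤ (suc m * suc m) (^-monoˡ-≤ (suc m * m) m[2+m]≤[1+m]²) ⟩
  suc m * suc m * (suc m * suc m) ^ (suc m * m)
    ≡⟨ cong (suc m * suc m *_) (trans (^-distribʳ-* (suc m * m) (suc m) (suc m))
        (sym (^-distribˡ-+-* (suc m) (suc m * m) (suc m * m)))) ⟩
  suc m * suc m * suc m ^ (suc m * m + suc m * m)
    ≡⟨ *-assoc (suc m) (suc m) (suc m ^ (suc m * m + suc m * m)) ⟩
  suc m ^ (2 + (suc m * m + suc m * m))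
    ≡⟨ cong (suc m ^_) (exponents k) ⟩
  suc m ^ (m * k + suc m * (2 + m))
    ≡⟨ ^-distribˡ-+-* (suc m) (m * k) (suc m * (2 + m)) ⟩
  suc m ^ (m * k) * suc m ^ (suc m * (2 + m)) ∎)
  where
  open ≤-Reasoning
  m : ℕ
  m = suc k
  lhs : ∀ a b c d → a * (b * c * (b * c) * d) ≡ c * c * a * (b * b * d)
  lhs = solve-∀
  swap : ∀ a b c → a * (b * c) ≡ b * (a * c)
  swap = solve-∀
  m[2+m]≤[1+m]² : m * (2 + m) ≤ suc m * suc m
  m[2+m]≤[1+m]² = subst (m * (2 + m) ≤_) (go m) (n≤1+n _)
    where
    go : ∀ m → suc (m * (2 + m)) ≡ suc m * suc m
    go = solve-∀
  exponents : ∀ k → 2 + ((2 + k) * suc k + (2 + k) * suc k) ≡ suc k * k + (2 + k) * (3 + k)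
  exponents = solve-∀

factorial-log-concave : ∀ k →
  (suc k !) ^ ((2 + k) * (3 + k)) * ((3 + k) !) ^ (suc k * (2 + k)) ≤
  ((2 + k) ! * (2 + k) !) ^ (suc k * (3 + k))
factorial-log-concave k = begin
  F ^ ((2 + k) * (3 + k)) * (suc m * (m * F)) ^ (suc k * (2 + k))
    ≡⟨ cong₂ (λ e f → F ^ e * f) (exp₁ k) (trans (^-distribʳ-* e₀ (suc m) (m * F))
        (cong (suc m ^ e₀ *_) (^-distribʳ-* e₀ m F))) ⟩
  F ^ (2 + (4 + k) * suc k) * (suc m ^ e₀ * (m ^ e₀ * F ^ e₀))
    ≡⟨ lhs F (F ^ ((4 + k) * suc k)) (suc m ^ e₀) (m ^ e₀) (F ^ e₀) ⟩
  F * F * suc m ^ e₀ * (m ^ e₀ * (F ^ ((4 + k) * suc k) * F ^ e₀))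
    ≤⟨ *-monoˡ-≤ _ bound ⟩
  m ^ ((4 + k) * suc k) * (m ^ e₀ * (F ^ ((4 + k) * suc k) * F ^ e₀))
    ≡⟨ rhs (m ^ ((4 + k) * suc k)) (m ^ e₀) (F ^ ((4 + k) * suc k)) (F ^ e₀) ⟩
  (m ^ ((4 + k) * suc k) * m ^ e₀) * (F ^ ((4 + k) * suc k) * F ^ e₀)
    ≡⟨ cong₂ _*_ (^-distribˡ-+-* m ((4 + k) * suc k) e₀) (^-distribˡ-+-* F ((4 + k) * suc k) e₀) ⟨
  m ^ ((4 + k) * suc k + e₀) * F ^ ((4 + k) * suc k + e₀)
    ≡⟨ ^-distribʳ-* ((4 + k) * suc k + e₀) m F ⟨
  (m * F) ^ ((4 + k) * suc k + e₀)
    ≡⟨ cong ((m * F) ^_) (exp₂ k) ⟩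
  (m * F) ^ (suc k * (3 + k) + suc k * (3 + k))
    ≡⟨ trans (^-distribˡ-+-* (m * F) (suc k * (3 + k)) (suc k * (3 + k)))
        (sym (^-distribʳ-* (suc k * (3 + k)) (m * F) (m * F))) ⟩
  (m * F * (m * F)) ^ (suc k * (3 + k)) ∎
  where
  open ≤-Reasoning
  m F e₀ : ℕ
  m = 2 + k
  F = suc k !
  e₀ = suc k * (2 + k)
  -- The exponent m (m+1) exceeds (m+2) (m-1) by 2, so the square `F * F` can be split off and
  -- absorbed by `bound`.
  exp₁ : ∀ k → (2 + k) * (3 + k) ≡ 2 + (4 + k) * suc k
  exp₁ = solve-∀
  exp₂ : ∀ k → (4 + k) * suc k + suc k * (2 + k) ≡ suc k * (3 + k) + suc k * (3 + k)
  exp₂ = solve-∀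
  lhs : ∀ F a b c d → F * (F * a) * (b * (c * d)) ≡ F * F * b * (c * (a * d))
  lhs = solve-∀
  rhs : ∀ a b c d → a * (b * (c * d)) ≡ a * b * (c * d)
  rhs = solve-∀
  bound : F * F * suc m ^ e₀ ≤ m ^ ((4 + k) * suc k)
  bound = *-cancelˡ-≤ (m * m) (begin
    m * m * (F * F * suc m ^ e₀)                  ≡⟨ regroup m F (suc m ^ e₀) ⟩
    m * F * (m * F) * suc m ^ e₀                  ≡⟨ cong (λ e → m * F * (m * F) * suc m ^ e)
        (*-comm (suc k) m) ⟩
    m * F * (m * F) * suc m ^ (m * suc k)         ≤⟨ m!²[1+m]^[m[m-1]]≤m^[m[1+m]] (suc k) ⟩
    m ^ (m * suc m)                               ≡⟨ cong (m ^_) (exp₁ k) ⟩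
    m * (m * m ^ ((4 + k) * suc k))               ≡⟨ *-assoc m m (m ^ ((4 + k) * suc k)) ⟨
    m * m * m ^ ((4 + k) * suc k)                 ∎)
    where
    regroup : ∀ m F x → m * m * (F * F * x) ≡ m * F * (m * F) * x
    regroup = solve-∀

-- Only one power of each of `x`, `y`, `z` is known, with three different exponents. Raising to the
-- product of these exponents expresses everything through factorials.
root-log-concave : ∀ k L {x y z} → x ^ suc k ≡ (suc k !) ^ L → z ^ (2 + k) ≡ ((2 + k) !) ^ L →
  y ^ (3 + k) ≡ ((3 + k) !) ^ L → x * y ≤ z * z
root-log-concave k L {x} {y} {z} x^ z^ y^ = ^-cancelˡ-≤ (suc k * ((2 + k) * (3 + k))) (begin
  (x * y) ^ (a * (b * c))                       ≡⟨ ^-distribʳ-* (a * (b * c)) x y ⟩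
  x ^ (a * (b * c)) * y ^ (a * (b * c))         ≡⟨ cong₂ _*_ (power x a (b * c) x^)
      (trans (cong (y ^_) (rot a b c)) (power y c (a * b) y^)) ⟩
  ((a !) ^ (b * c)) ^ L * ((c !) ^ (a * b)) ^ L ≡⟨ ^-distribʳ-* L _ _ ⟨
  ((a !) ^ (b * c) * (c !) ^ (a * b)) ^ L       ≤⟨ ^-monoˡ-≤ L (factorial-log-concave k) ⟩
  ((b ! * b !) ^ (a * c)) ^ L                   ≡⟨ cong (_^ L) (^-distribʳ-* (a * c) (b !) (b !)) ⟩
  ((b !) ^ (a * c) * (b !) ^ (a * c)) ^ L       ≡⟨ ^-distribʳ-* L _ _ ⟩
  ((b !) ^ (a * c)) ^ L * ((b !) ^ (a * c)) ^
      L ≡⟨ cong (λ u → u * u) (trans (cong (z ^_) (swap a b c)) (power z b (a * c) z^)) ⟨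
  z ^ (a * (b * c)) * z ^ (a * (b * c))         ≡⟨ ^-distribʳ-* (a * (b * c)) z z ⟨
  (z * z) ^ (a * (b * c))                       ∎)
  where
  open ≤-Reasoning
  a b c : ℕ
  a = suc k
  b = 2 + k
  c = 3 + k
  rot : ∀ a b c → a * (b * c) ≡ c * (a * b)
  rot = solve-∀
  swap : ∀ a b c → a * (b * c) ≡ b * (a * c)
  swap = solve-∀
  power : ∀ x d e → x ^ d ≡ (d !) ^ L → x ^ (d * e) ≡ ((d !) ^ e) ^ L
  power x d e eq = trans (sym (^-*-assoc x d e)) (trans (cong (_^ e) eq)
    (trans (^-*-assoc (d !) L e) (trans (cong ((d !) ^_) (*-comm L e)) (sym (^-*-assoc (d !) e L)))))

-- Hafnians on vertex subsets

χ : Bool → ℕ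
χ true  = 1
χ false = 0

χ-∧ : ∀ a b → χ (a ∧ b) ≡ χ a * χ b
χ-∧ true  b = sym (+-identityʳ (χ b))
χ-∧ false b = refl

private
  variable
    A B : Set

-- Sums over lists and over their sublists

∑ₗ : List A → (A → ℕ) → ℕ
∑ₗ xs g = listSum (map g xs)

∑ₗ-++ : ∀ (xs ys : List A) g → ∑ₗ (xs ++ ys) g ≡ ∑ₗ xs g + ∑ₗ ys g
∑ₗ-++ xs ys g = trans (cong listSum (map-++ g xs ys)) (sum-++ (map g xs) (map g ys))

∑ₗ-cong : ∀ (xs : List A) {g h : A → ℕ} → (∀ x → g x ≡ h x) → ∑ₗ xs g ≡ ∑ₗ xs h
∑ₗ-cong xs g≗h = cong listSum (map-cong g≗h xs)

∑ₗ-+ : ∀ (xs : List A) (g h : A → ℕ) → ∑ₗ xs (λ x → g x + h x) ≡ ∑ₗ xs g + ∑ₗ xs h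
∑ₗ-+ []       g h = refl
∑ₗ-+ (x ∷ xs) g h = trans (cong (g x + h x +_) (∑ₗ-+ xs g h)) (interchange (g x) (h x) (∑ₗ xs g) (∑ₗ xs h))
  where
  interchange : ∀ a b c d → a + b + (c + d) ≡ a + c + (b + d)
  interchange = solve-∀

∑ₗ-* : ∀ k (xs : List A) (g : A → ℕ) → ∑ₗ xs (λ x → k * g x) ≡ k * ∑ₗ xs g
∑ₗ-* k []       g = sym (*-zeroʳ k)
∑ₗ-* k (x ∷ xs) g = trans (cong (k * g x +_) (∑ₗ-* k xs g)) (sym (*-distribˡ-+ k (g x) (∑ₗ xs g)))

∑ₗ-zero : ∀ (xs : List A) {g : A → ℕ} → (∀ x → g x ≡ 0) → ∑ₗ xs g ≡ 0
∑ₗ-zero []       g≡0 = refl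
∑ₗ-zero (x ∷ xs) g≡0 = cong₂ _+_ (g≡0 x) (∑ₗ-zero xs g≡0)

∑ₗ-map : ∀ (f : B → A) xs (g : A → ℕ) → ∑ₗ (map f xs) g ≡ ∑ₗ xs (g ∘ f)
∑ₗ-map f xs g = cong listSum (sym (map-∘ xs))

length≡∑ₗ : ∀ (xs : List A) → length xs ≡ ∑ₗ xs (λ _ → 1)
length≡∑ₗ []       = refl
length≡∑ₗ (x ∷ xs) = cong suc (length≡∑ₗ xs)

∑ₗ-filter : ∀ {P : A → Set} (P? : Decidable₁ P) xs (g : A → ℕ) →
  ∑ₗ (filter P? xs) g ≡ ∑ₗ xs (λ x → χ (does (P? x)) * g x)
∑ₗ-filter P? []       g = refl
∑ₗ-filter P? (x ∷ xs) g with does (P? x)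
... | true  = cong₂ _+_ (sym (+-identityʳ (g x))) (∑ₗ-filter P? xs g)
... | false = ∑ₗ-filter P? xs g

filter-map : ∀ {P : A → Set} (P? : Decidable₁ P) (f : B → A) xs →
  filter P? (map f xs) ≡ map f (filter (P? ∘ f) xs)
filter-map P? f []       = refl
filter-map P? f (x ∷ xs) with does (P? (f x))
... | true  = cong (f x ∷_) (filter-map P? f xs)
... | false = filter-map P? f xs

∑ₗ-filter-sublists : ∀ {P : List A → Set} (P? : Decidable₁ P) x xs (g : List A → ℕ) →
  ∑ₗ (filter P? (sublists (x ∷ xs))) g ≡
  ∑ₗ (filter (P? ∘ (x ∷_)) (sublists xs)) (g ∘ (x ∷_)) + ∑ₗ (filter P? (sublists xs)) g
∑ₗ-filter-sublists P? x xs g = trans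
  (cong (λ Ms → ∑ₗ Ms g) (filter-++ P? (map (x ∷_) (sublists xs)) (sublists xs)))
  (trans (∑ₗ-++ (filter P? (map (x ∷_) (sublists xs))) (filter P? (sublists xs)) g)
    (cong (_+ ∑ₗ (filter P? (sublists xs)) g)
      (trans (cong (λ Ms → ∑ₗ Ms g) (filter-map P? (x ∷_) (sublists xs)))
          (∑ₗ-map (x ∷_) (filter (P? ∘ (x ∷_)) (sublists xs)) g))))

-- This is what identifies `perfmat` with a hafnian: a sublist containing an element rejected by
-- `Q?` has weight 0, and all others have weight 1. The predicate is arbitrary because choosing `x`
-- replaces `P?` by `P? ∘ (x ∷_)`.
length-filter-sublists-filter : ∀ {P : List A → Set} {Q : A → Set}
  (P? : Decidable₁ P) (Q? : Decidable₁ Q) xs →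
  length (filter P? (sublists (filter Q? xs))) ≡
  ∑ₗ (filter P? (sublists xs)) (λ M → product (map (λ x → χ (does (Q? x))) M))
length-filter-sublists-filter P? Q? []       with does (P? [])
... | true  = refl
... | false = refl
length-filter-sublists-filter P? Q? (x ∷ xs) with does (Q? x) in eq
... | true  = begin
  length (filter P? (sublists (x ∷ filter Q? xs)))
    ≡⟨ trans (length≡∑ₗ (filter P? (sublists (x ∷ filter Q? xs))))
        (∑ₗ-filter-sublists P? x (filter Q? xs) (λ _ → 1)) ⟩
  ∑ₗ (filter (P? ∘ (x ∷_)) (sublists (filter Q? xs))) (λ _ → 1) + ∑ₗ (filter P? (sublists (filter Q? xs)))
      (λ _ → 1)
    ≡⟨ cong₂ _+_ (sym (length≡∑ₗ (filter (P? ∘ (x ∷_)) (sublists (filter Q? xs)))))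
        (sym (length≡∑ₗ (filter P? (sublists (filter Q? xs))))) ⟩
  length (filter (P? ∘ (x ∷_)) (sublists (filter Q? xs))) + length (filter P? (sublists (filter Q? xs)))
    ≡⟨ cong₂ _+_ (length-filter-sublists-filter (P? ∘ (x ∷_)) Q? xs) (length-filter-sublists-filter P? Q? xs) ⟩
  ∑ₗ (filter (P? ∘ (x ∷_)) (sublists xs)) w + ∑ₗ (filter P? (sublists xs)) w
    ≡⟨ cong (_+ ∑ₗ (filter P? (sublists xs)) w)
        (∑ₗ-cong (filter (P? ∘ (x ∷_)) (sublists xs)) {w} {w ∘ (x ∷_)}
        (λ M → trans (sym (*-identityˡ (w M))) (cong (λ b → χ b * w M) (sym eq)))) ⟩
  ∑ₗ (filter (P? ∘ (x ∷_)) (sublists xs)) (w ∘ (x ∷_)) + ∑ₗ (filter P? (sublists xs)) w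
    ≡⟨ ∑ₗ-filter-sublists P? x xs w ⟨
  ∑ₗ (filter P? (sublists (x ∷ xs))) w ∎
  where
  open ≡-Reasoning
  w = λ M → product (map (λ x → χ (does (Q? x))) M)
... | false = begin
  length (filter P? (sublists (filter Q? xs)))
    ≡⟨ length-filter-sublists-filter P? Q? xs ⟩
  ∑ₗ (filter P? (sublists xs)) w
    ≡⟨ cong (_+ ∑ₗ (filter P? (sublists xs)) w)
        (∑ₗ-zero (filter (P? ∘ (x ∷_)) (sublists xs)) (λ M → cong (λ b → χ b * w M) eq)) ⟨
  ∑ₗ (filter (P? ∘ (x ∷_)) (sublists xs)) (w ∘ (x ∷_)) + ∑ₗ (filter P? (sublists xs)) w
    ≡⟨ ∑ₗ-filter-sublists P? x xs w ⟨
  ∑ₗ (filter P? (sublists (x ∷ xs))) w ∎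
  where
  open ≡-Reasoning
  w = λ M → product (map (λ x → χ (does (Q? x))) M)

∑ₗ-tabulate : ∀ {n} (f : Fin n → A) (g : A → ℕ) → ∑ₗ (tabulate f) g ≡ sum (g ∘ f)
∑ₗ-tabulate {n = zero}  f g = refl
∑ₗ-tabulate {n = suc n} f g = cong (g (f zero) +_) (∑ₗ-tabulate (f ∘ suc) g)

∑ₗ-cartesianProduct : ∀ (xs : List A) (ys : List B) (g : A × B → ℕ) →
  ∑ₗ (cartesianProduct xs ys) g ≡ ∑ₗ xs (λ x → ∑ₗ ys (λ y → g (x , y)))
∑ₗ-cartesianProduct []       ys g = refl
∑ₗ-cartesianProduct (x ∷ xs) ys g = trans (∑ₗ-++ (map (x ,_) ys) (cartesianProduct xs ys) g)
  (cong₂ _+_ (∑ₗ-map (x ,_) ys g) (∑ₗ-cartesianProduct xs ys g))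

module _ {n : ℕ} where

  δ ne : Fin n → Fin n → ℕ
  δ i j = χ (does (i Fin.≟ j))
  ne i j = χ (not (does (i Fin.≟ j)))

  ne-refl : ∀ i → ne i i ≡ 0
  ne-refl i rewrite dec-true (i Fin.≟ i) refl = refl

  ne-≢ : ∀ {i j} → i ≢ j → ne i j ≡ 1
  ne-≢ {i} {j} i≢j rewrite dec-false (i Fin.≟ j) i≢j = refl

  ne-sym : ∀ i j → ne i j ≡ ne j i
  ne-sym i j with i Fin.≟ j
  ... | yes refl = sym (ne-refl i)
  ... | no i≢j   = sym (ne-≢ (i≢j ∘ sym))

∑-δ : ∀ {n} (i : Fin n) (g : Fin n → ℕ) → sum (λ j → δ i j * g j) ≡ g i
∑-δ {suc n} zero    g = trans (cong (1 * g zero +_) (sum-replicate-zero n))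
    (trans (+-identityʳ _) (*-identityˡ (g zero)))
∑-δ {suc n} (suc i) g = trans (sum-cong-≗ λ j → cong (_* g (suc j)) (δ-suc j)) (∑-δ i (g ∘ suc))
  where
  δ-suc : ∀ j → δ (suc i) (suc j) ≡ δ i j
  δ-suc j with i Fin.≟ j
  ... | yes _ = refl
  ... | no  _ = refl

-- Vertex subsets and their perfect matchings

VertexSet : ℕ → Set
VertexSet n = Fin n → Bool

module _ {n : ℕ} where

  infixl 6 _∖_

  _∖_ : VertexSet n → Fin n → VertexSet n
  (S ∖ v) u = S u ∧ not (does (u Fin.≟ v))

  χ-∖∖ : ∀ S v w u → χ ((S ∖ v ∖ w) u) ≡ χ (S u) * ne u v * ne u w
  χ-∖∖ S v w u = trans (χ-∧ (S u ∧ not (does (u Fin.≟ v))) _) (cong (_* ne u w) (χ-∧ (S u) _))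

  ∖-comm : ∀ S v w → S ∖ v ∖ w ≗ S ∖ w ∖ v
  ∖-comm S v w u with S u
  ... | false = refl
  ... | true  with u Fin.≟ v | u Fin.≟ w
  ...   | yes _ | yes _ = refl
  ...   | yes _ | no  _ = refl
  ...   | no  _ | yes _ = refl
  ...   | no  _ | no  _ = refl

  ∖-cong : ∀ {S T} v → S ≗ T → S ∖ v ≗ T ∖ v
  ∖-cong v S≗T u = cong (_∧ _) (S≗T u)

  ∖∖-≢ : ∀ S {v w u} → u ≢ v → u ≢ w → (S ∖ v ∖ w) u ≡ S u
  ∖∖-≢ S {v} {w} {u} u≢v u≢w rewrite dec-false (u Fin.≟ v) u≢v | dec-false (u Fin.≟ w) u≢w with S u
  ... | true  = refl
  ... | false = refl

  ∖∖-ˡ : ∀ S v w → (S ∖ v ∖ w) v ≡ false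
  ∖∖-ˡ S v w rewrite dec-true (v Fin.≟ v) refl | ∧-zeroʳ (S v) = refl

  ∖∖-ʳ : ∀ S v w → (S ∖ v ∖ w) w ≡ false
  ∖∖-ʳ S v w rewrite dec-true (w Fin.≟ w) refl = ∧-zeroʳ _

  -- Vertices outside `S` must be covered 0 times. Hence the list of edges can stay fixed while only
  -- `S` shrinks.
  IsPerfectOn : VertexSet n → List (Edge n) → Set
  IsPerfectOn S M = ∀ v → length (filter (incident? v) M) ≡ χ (S v)

  isPerfectOn? : ∀ S → Decidable₁ (IsPerfectOn S)
  isPerfectOn? S M = Fin.all? λ v → length (filter (incident? v) M) ≟ χ (S v)

  ∷-perfect⁻ : ∀ {S i j M} → IsPerfectOn S ((i , j) ∷ M) →
    S i ≡ true × S j ≡ true × IsPerfectOn (S ∖ i ∖ j) M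
  ∷-perfect⁻ {S} {i} {j} {M} perf = end i (inj₁ refl) , end j (inj₂ refl) , rest
    where
    hit : ∀ v → Incident v (i , j) → suc (length (filter (incident? v) M)) ≡ χ (S v)
    hit v inc = trans (cong length (sym (filter-accept (incident? v) {xs = M} inc))) (perf v)
    end : ∀ v → Incident v (i , j) → S v ≡ true
    end v inc with S v | hit v inc
    ... | true | _ = refl
    none : ∀ v → Incident v (i , j) → length (filter (incident? v) M) ≡ 0
    none v inc = suc-injective (trans (hit v inc) (cong χ (end v inc)))
    rest : IsPerfectOn (S ∖ i ∖ j) M
    rest v with v Fin.≟ i
    rest v | yes refl = trans (none v (inj₁ refl)) (cong χ (sym (cong (_∧ _) (∧-zeroʳ (S v)))))
    rest v | no v≢i   with v Fin.≟ j
    rest v | no v≢i   | yes refl = trans (none v (inj₂ refl)) (cong χ (sym (∧-zeroʳ _)))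
    rest v | no v≢i   | no v≢j   = trans
      (cong length (sym (filter-reject (incident? v) {xs = M} λ { (inj₁ p) → v≢i p ; (inj₂ p) → v≢j p })))
      (trans (perf v) (cong χ (∧-true (S v))))
      where
      ∧-true : ∀ b → b ≡ (b ∧ true) ∧ true
      ∧-true true  = refl
      ∧-true false = refl

  ∷-perfect⁺ : ∀ {S i j M} → S i ≡ true → S j ≡ true → IsPerfectOn (S ∖ i ∖ j) M →
    IsPerfectOn S ((i , j) ∷ M)
  ∷-perfect⁺ {S} {i} {j} {M} Si Sj perf v with incident? v (i , j)
  ... | yes (inj₁ refl) = trans (cong length (filter-accept (incident? v) {xs = M} (inj₁ refl)))
    (trans (cong suc (trans (perf v) (cong χ (∖∖-ˡ S v j)))) (cong χ (sym Si)))
  ... | yes (inj₂ refl) = trans (cong length (filter-accept (incident? v) {xs = M} (inj₂ refl)))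
    (trans (cong suc (trans (perf v) (cong χ (∖∖-ʳ S i v)))) (cong χ (sym Sj)))
  ... | no ¬inc = trans (cong length (filter-reject (incident? v) {xs = M} ¬inc))
    (trans (perf v) (cong χ (∖∖-≢ S (¬inc ∘ inj₁) (¬inc ∘ inj₂))))

module _ {n : ℕ} (A : Matrix n) where

  weight : List (Edge n) → ℕ
  weight M = product (map (λ (i , j) → A i j) M)

  -- The hafnian of A restricted to the vertex set S and the edges E, expanded along E.
  haf : List (Edge n) → VertexSet n → ℕ
  haf []            S = ∑ₗ (filter (isPerfectOn? S) ([] ∷ [])) weight
  haf ((i , j) ∷ E) S = χ (S i) * χ (S j) * (A i j * haf E (S ∖ i ∖ j)) + haf E S

  haf≡∑ : ∀ E S → haf E S ≡ ∑ₗ (filter (isPerfectOn? S) (sublists E)) weight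
  haf≡∑ []              S = refl
  haf≡∑ (e@(i , j) ∷ E) S = sym (trans (∑ₗ-filter-sublists (isPerfectOn? S) e E weight)
    (cong₂ _+_ with-e (sym (haf≡∑ E S))))
    where
    unmatched : S i ≡ false ⊎ S j ≡ false →
      ∑ₗ (filter (isPerfectOn? S ∘ (e ∷_)) (sublists E)) (weight ∘ (e ∷_)) ≡ 0
    unmatched out = cong (λ Ms → ∑ₗ Ms (weight ∘ (e ∷_)))
      (filter-none (isPerfectOn? S ∘ (e ∷_)) (All.universal (λ M perf → absurd out (∷-perfect⁻ perf))
          (sublists E)))
      where
      absurd : ∀ {X : Set} → S i ≡ false ⊎ S j ≡ false → ¬ (S i ≡ true × S j ≡ true × X)
      absurd (inj₁ p) (q , _ , _) with () ← trans (sym p) q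
      absurd (inj₂ p) (_ , q , _) with () ← trans (sym p) q
    with-e : ∑ₗ (filter (isPerfectOn? S ∘ (e ∷_)) (sublists E)) (weight ∘ (e ∷_)) ≡
      χ (S i) * χ (S j) * (A i j * haf E (S ∖ i ∖ j))
    with-e with S i in Si | S j in Sj
    ... | false | _     = unmatched (inj₁ Si)
    ... | true  | false = unmatched (inj₂ Sj)
    ... | true  | true  = begin
      ∑ₗ (filter (isPerfectOn? S ∘ (e ∷_)) (sublists E)) (weight ∘ (e ∷_))
        ≡⟨ ∑ₗ-* (A i j) (filter (isPerfectOn? S ∘ (e ∷_)) (sublists E)) weight ⟩
      A i j * ∑ₗ (filter (isPerfectOn? S ∘ (e ∷_)) (sublists E)) weight
        ≡⟨ cong (λ Ms → A i j * ∑ₗ Ms weight) (filter-≐ (isPerfectOn? S ∘ (e ∷_)) (isPerfectOn? (S ∖ i ∖ j))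
             ((λ perf → proj₂ (proj₂ (∷-perfect⁻ perf))) , ∷-perfect⁺ Si Sj) (sublists E)) ⟩
      A i j * ∑ₗ (filter (isPerfectOn? (S ∖ i ∖ j)) (sublists E)) weight
        ≡⟨ cong (A i j *_) (haf≡∑ E (S ∖ i ∖ j)) ⟨
      A i j * haf E (S ∖ i ∖ j)
        ≡⟨ +-identityʳ _ ⟨
      1 * (A i j * haf E (S ∖ i ∖ j)) ∎
      where open ≡-Reasoning

  haf-cong : ∀ E {S T} → S ≗ T → haf E S ≡ haf E T
  haf-cong []            {S} {T} S≗T = cong (λ Ms → ∑ₗ Ms weight) (filter-≐ (isPerfectOn? S) (isPerfectOn? T)
    ((λ perf v → trans (perf v) (cong χ (S≗T v))) , (λ perf v → trans (perf v) (cong χ (sym (S≗T v)))))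
        ([] ∷ []))
  haf-cong ((i , j) ∷ E) {S} {T} S≗T rewrite S≗T i | S≗T j = cong₂ (λ x y → χ (T i) * χ (T j) * (A i j * x) + y)
    (haf-cong E (∖-cong j (∖-cong i S≗T))) (haf-cong E S≗T)

  haf-[]-full : ∀ S {v} → S v ≡ true → haf [] S ≡ 0
  haf-[]-full S {v} Sv rewrite dec-false (isPerfectOn? S []) (λ perf → 0≢1+n (trans (perf v) (cong χ Sv))) =
      refl

  haf-[]-≤1 : ∀ S → haf [] S ≤ 1
  haf-[]-≤1 S with does (isPerfectOn? S [])
  ... | true  = ≤-refl
  ... | false = z≤n

  haf-empty : ∀ E {S} → (∀ v → S v ≡ false) → haf E S ≤ 1
  haf-empty []            {S} _    = haf-[]-≤1 S
  haf-empty ((i , j) ∷ E) {S} S≡∅ rewrite S≡∅ i = haf-empty E S≡∅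

-- Expansion of the hafnian along a row

Proper : ∀ {n} → Edge n → Set
Proper (i , j) = i ≢ j

pairs-proper : ∀ n → All Proper (pairs n)
pairs-proper n = All.map (λ i<j i≡j → Fin.<-irrefl i≡j i<j)
  (all-filter (λ (i , j) → i Fin.<? j) (cartesianProduct (allFin n) (allFin n)))

module _ {n : ℕ} (A : Matrix n) where

  incidence : Fin n → Edge n → ℕ
  incidence v (i , j) = δ v i + δ v j

  -- For `E` = `pairs n` these are the numbers c of the overview, restricted to `S`. The pair need
  -- not occur in `E` and may be given in either order, so that they form a symmetric matrix.
  removal : List (Edge n) → VertexSet n → Edge n → ℕ
  removal E S (i , j) = χ (S i) * χ (S j) * (A i j * haf A E (S ∖ i ∖ j))

  removal-sym : IsSymmetric A → ∀ E S i j → removal E S (i , j) ≡ removal E S (j , i)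
  removal-sym A-sym E S i j = cong₂ _*_ (*-comm (χ (S i)) (χ (S j)))
    (cong₂ _*_ (A-sym i j) (haf-cong A E (∖-comm S i j)))

  -- Disjointness of the edge `e` from (i , j) is a symmetric condition: its factors `ne` can be
  -- charged to the ends of either edge, and the order in which the four vertices are deleted does
  -- not matter.
  removal-∷ : ∀ i j E S e → removal ((i , j) ∷ E) S e ≡
    χ (S i) * χ (S j) * (A i j * removal E (S ∖ i ∖ j) e) + removal E S e
  removal-∷ i j E S (k , l) = trans
    (cong (λ h → χ (S k) * χ (S l) * (A k l * h))
      (cong₂ (λ p q → p * q * (A i j * haf A E (S ∖ k ∖ l ∖ i ∖ j)) + haf A E (S ∖ k ∖ l)) (χ-∖∖ S k l i)
          (χ-∖∖ S k l j)))
    (trans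
      (regroup (χ (S i)) (χ (S j)) (χ (S k)) (χ (S l)) (ne i k) (ne i l) (ne j k) (ne j l)
        (A i j) (A k l) (haf A E (S ∖ k ∖ l ∖ i ∖ j)) (haf A E (S ∖ k ∖ l)))
      (cong (λ t → χ (S i) * χ (S j) * (A i j * t) + removal E S (k , l))
        (cong₂ (λ pq h → pq * (A k l * h)) (cong₂ _*_ (ends k) (ends l)) (haf-cong A E commute))))
    where
    regroup : ∀ a b c d p q r s x y h g →
      c * d * (y * (a * p * q * (b * r * s) * (x * h) + g)) ≡
      a * b * (x * (c * p * r * (d * q * s) * (y * h))) + c * d * (y * g)
    regroup = solve-∀
    ends : ∀ k → χ (S k) * ne i k * ne j k ≡ χ ((S ∖ i ∖ j) k)
    ends k = trans (cong₂ (λ p q → χ (S k) * p * q) (ne-sym i k) (ne-sym j k)) (sym (χ-∖∖ S i j k))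
    commute : S ∖ k ∖ l ∖ i ∖ j ≗ S ∖ i ∖ j ∖ k ∖ l
    commute u with S u
    ... | false = refl
    ... | true with u Fin.≟ i | u Fin.≟ j | u Fin.≟ k | u Fin.≟ l
    ... | no  _ | b     | c     | d     = swap (not (does b)) (not (does c)) (not (does d))
      where
      swap : ∀ b c d → ((c ∧ d) ∧ true) ∧ b ≡ (b ∧ c) ∧ d
      swap true  true  true  = refl
      swap true  true  false = refl
      swap true  false true  = refl
      swap true  false false = refl
      swap false true  true  = refl
      swap false true  false = refl
      swap false false true  = refl
      swap false false false = refl
    ... | yes _ | b     | c     | d     = swap (not (does b)) (not (does c)) (not (does d))
      where
      swap : ∀ b c d → ((c ∧ d) ∧ false) ∧ b ≡ false
      swap b true  true  = refl
      swap b true  false = refl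
      swap b false d     = refl

  -- A perfect matching has exactly one edge at `v`. In the induction, the weight `w` of the
  -- matchings through the first edge (i , j) must appear once: it comes from that edge itself if
  -- `v` is one of its ends, and otherwise from the later edges, by the induction hypothesis with
  -- `i` and `j` deleted. A loop at `v` would be counted twice, hence `Proper`.
  haf-expand : ∀ {E} → All Proper E → ∀ S {v} → S v ≡ true →
    haf A E S ≡ ∑ₗ E (λ e → incidence v e * removal E S e)
  haf-expand []                               S Sv = haf-[]-full A S Sv
  haf-expand {(i , j) ∷ E} (i≢j ∷ E-proper) S {v} Sv = sym (begin
    (δ v i + δ v j) * removal (e ∷ E) S e + ∑ₗ E (λ f → incidence v f * removal (e ∷ E) S f)
      ≡⟨ cong₂ _+_ head-term tail-terms ⟩
    (δ v i + δ v j) * w + (ne v i * ne v j * w + haf A E S)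
      ≡⟨ regroup (δ v i + δ v j) (ne v i * ne v j) w (haf A E S) ⟩
    (δ v i + δ v j + ne v i * ne v j) * w + haf A E S
      ≡⟨ cong (λ t → t * w + haf A E S) hit-or-miss ⟩
    1 * w + haf A E S
      ≡⟨ cong (_+ haf A E S) (*-identityˡ w) ⟩
    w + haf A E S ∎)
    where
    open ≡-Reasoning
    e : Edge n
    e = i , j
    S′ : VertexSet n
    S′ = S ∖ i ∖ j
    w : ℕ
    w = χ (S i) * χ (S j) * (A i j * haf A E S′)
    regroup : ∀ a b w h → a * w + (b * w + h) ≡ (a + b) * w + h
    regroup = solve-∀
    hit-or-miss : δ v i + δ v j + ne v i * ne v j ≡ 1
    hit-or-miss with v Fin.≟ i | v Fin.≟ j
    ... | yes refl | yes refl = contradiction refl i≢j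
    ... | yes _    | no  _    = refl
    ... | no  _    | yes _    = refl
    ... | no  _    | no  _    = refl
    head-term : incidence v e * removal (e ∷ E) S e ≡ incidence v e * w
    -- Once its ends are deleted the first edge cannot be used again, so the expansion along `e ∷ E`
    -- reduces to the one along `E`.
    head-term = cong (λ h → incidence v e * (χ (S i) * χ (S j) * (A i j * h)))
      (cong (λ b → χ b * χ (S′ j) * (A i j * haf A E (S′ ∖ i ∖ j)) + haf A E S′) (∖∖-ˡ S i j))
    S′v : χ (S′ v) ≡ ne v i * ne v j
    S′v = trans (χ-∖∖ S i j v)
      (trans (cong (λ b → χ b * ne v i * ne v j) Sv) (cong (_* ne v j) (*-identityˡ (ne v i))))
    missing : S′ v ≡ false → ∀ f → incidence v f * removal E S′ f ≡ 0
    missing S′v≡false (k , l) with v Fin.≟ k | v Fin.≟ l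
    ... | yes refl | v≟l      rewrite S′v≡false = *-zeroʳ (χ (does v≟l))
    ... | no _     | yes refl rewrite S′v≡false | *-zeroʳ (χ (S′ k)) = refl
    ... | no _     | no _     = refl
    sum-removal : ∀ b → S′ v ≡ b → ∑ₗ E (λ f → incidence v f * removal E S′ f) ≡ χ b * haf A E S′
    sum-removal true  eq = trans (sym (haf-expand E-proper S′ eq)) (sym (*-identityˡ _))
    sum-removal false eq = ∑ₗ-zero E (missing eq)
    tail-terms : ∑ₗ E (λ f → incidence v f * removal (e ∷ E) S f) ≡ ne v i * ne v j * w + haf A E S
    tail-terms = begin
      ∑ₗ E (λ f → incidence v f * removal (e ∷ E) S f)
        ≡⟨ ∑ₗ-cong E (λ f → trans (cong (incidence v f *_) (removal-∷ i j E S f))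
             (spread (incidence v f) (χ (S i) * χ (S j)) (A i j) (removal E S′ f) (removal E S f))) ⟩
      ∑ₗ E (λ f → χ (S i) * χ (S j) * A i j * (incidence v f * removal E S′ f) + incidence v f * removal E S f)
        ≡⟨ ∑ₗ-+ E _ _ ⟩
      ∑ₗ E (λ f → χ (S i) * χ (S j) * A i j * (incidence v f * removal E S′ f)) + ∑ₗ E
          (λ f → incidence v f * removal E S f)
        ≡⟨ cong₂ _+_ (∑ₗ-* (χ (S i) * χ (S j) * A i j) E _) (sym (haf-expand E-proper S Sv)) ⟩
      χ (S i) * χ (S j) * A i j * ∑ₗ E (λ f → incidence v f * removal E S′ f) + haf A E S
        ≡⟨ cong (λ t → χ (S i) * χ (S j) * A i j * t + haf A E S)
             (trans (sum-removal (S′ v) refl) (cong (_* haf A E S′) S′v)) ⟩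
      χ (S i) * χ (S j) * A i j * (ne v i * ne v j * haf A E S′) + haf A E S
        ≡⟨ cong (_+ haf A E S) (collect (χ (S i) * χ (S j)) (A i j) (ne v i * ne v j) (haf A E S′)) ⟩
      ne v i * ne v j * w + haf A E S ∎
      where
      spread : ∀ c s a x y → c * (s * (a * x) + y) ≡ s * a * (c * x) + c * y
      spread = solve-∀
      collect : ∀ s a m h → s * a * (m * h) ≡ m * (s * (a * h))
      collect = solve-∀

∑ₗ-allFin² : ∀ {n} (g : Edge n → ℕ) →
  ∑ₗ (cartesianProduct (allFin n) (allFin n)) g ≡ sum (λ i → sum (λ j → g (i , j)))
∑ₗ-allFin² {n} g = trans (∑ₗ-cartesianProduct (allFin n) (allFin n) g)
  (trans (∑ₗ-tabulate id (λ i → ∑ₗ (allFin n) (λ j → g (i , j))))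
    (sum-cong-≗ λ i → ∑ₗ-tabulate id (λ j → g (i , j))))

-- The edge vw occurs in `pairs n` once, oriented by the order of its ends; symmetry of `X` makes
-- the orientation immaterial, and the entry at `v` itself, which no pair produces, is 0.
∑-pairs : ∀ {n} (v : Fin n) (X : Edge n → ℕ) → (∀ i j → X (i , j) ≡ X (j , i)) → X (v , v) ≡ 0 →
  ∑ₗ (pairs n) (λ (i , j) → (δ v i + δ v j) * X (i , j)) ≡ sum (λ w → X (v , w))
∑-pairs {n} v X X-sym Xvv = begin
  ∑ₗ (pairs n) (λ (i , j) → (δ v i + δ v j) * X (i , j))
    ≡⟨ trans (∑ₗ-filter (λ (i , j) → i Fin.<? j) (cartesianProduct (allFin n) (allFin n)) _)
        (∑ₗ-allFin² {n} _) ⟩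
  sum (λ i → sum (λ j → lt i j * ((δ v i + δ v j) * X (i , j))))
    ≡⟨ sum-cong-≗ (λ i → trans (sum-cong-≗ (λ j → spread (lt i j) (δ v i) (δ v j) (X (i , j))))
         (∑-distrib-+ (λ j → δ v i * (lt i j * X (i , j))) (λ j → δ v j * (lt i j * X (i , j))))) ⟩
  sum (λ i → sum (λ j → δ v i * (lt i j * X (i , j))) + sum (λ j → δ v j * (lt i j * X (i , j))))
    ≡⟨ sum-cong-≗ (λ i → cong₂ _+_ (sym (*-distribˡ-sum (δ v i) (λ j → lt i j * X (i , j))))
        (∑-δ v (λ j → lt i j * X (i , j)))) ⟩
  sum (λ i → δ v i * sum (λ j → lt i j * X (i , j)) + lt i v * X (i , v))
    ≡⟨ ∑-distrib-+ (λ i → δ v i * sum (λ j → lt i j * X (i , j))) (λ i → lt i v * X (i , v)) ⟩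
  sum (λ i → δ v i * sum (λ j → lt i j * X (i , j))) + sum (λ i → lt i v * X (i , v))
    ≡⟨ cong (_+ sum (λ i → lt i v * X (i , v))) (∑-δ v (λ i → sum (λ j → lt i j * X (i , j)))) ⟩
  sum (λ w → lt v w * X (v , w)) + sum (λ w → lt w v * X (w , v))
    ≡⟨ ∑-distrib-+ (λ w → lt v w * X (v , w)) (λ w → lt w v * X (w , v)) ⟨
  sum (λ w → lt v w * X (v , w) + lt w v * X (w , v))
    ≡⟨ sum-cong-≗ merge ⟩
  sum (λ w → X (v , w)) ∎
  where
  open ≡-Reasoning
  lt : Fin n → Fin n → ℕ
  lt i j = χ (does (i Fin.<? j))
  spread : ∀ l a b x → l * ((a + b) * x) ≡ a * (l * x) + b * (l * x)
  spread = solve-∀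
  merge : ∀ w → lt v w * X (v , w) + lt w v * X (w , v) ≡ X (v , w)
  merge w with Fin.<-cmp v w
  ... | tri< v<w _ w≮v rewrite dec-true (v Fin.<? w) v<w | dec-false (w Fin.<? v) w≮v =
    trans (+-identityʳ _) (*-identityˡ _)
  ... | tri> v≮w _ w<v rewrite dec-false (v Fin.<? w) v≮w | dec-true (w Fin.<? v) w<v =
    trans (*-identityˡ _) (X-sym w v)
  ... | tri≈ _ refl _ rewrite Xvv | *-zeroʳ (lt v v) = refl

haf-row : ∀ {n} (A : Matrix n) → IsSymmetric A → ZeroDiagonal A → ∀ S {v} → S v ≡ true →
  haf A (pairs n) S ≡ sum (λ w → removal A (pairs n) S (v , w))
haf-row {n} A A-sym A-diag S {v} Sv = trans (haf-expand A (pairs-proper n) S Sv)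
  (∑-pairs v (removal A (pairs n) S) (removal-sym A A-sym (pairs n) S)
    (trans (cong (λ a → χ (S v) * χ (S v) * (a * haf A (pairs n) (S ∖ v ∖ v))) (A-diag v))
        (*-zeroʳ (χ (S v) * χ (S v)))))

-- The entropy induction

prod-mono-≤ : ∀ {n} {f g : Vector ℕ n} → (∀ i → f i ≤ g i) → prod f ≤ prod g
prod-mono-≤ {zero}  f≤g = ≤-refl
prod-mono-≤ {suc n} f≤g = *-mono-≤ (f≤g zero) (prod-mono-≤ (f≤g ∘ suc))

prod-^ : ∀ {n} (f : Vector ℕ n) k → prod (λ i → f i ^ k) ≡ prod f ^ k
prod-^ {zero}  f k = sym (^-zeroˡ k)
prod-^ {suc n} f k = trans (cong (f zero ^ k *_) (prod-^ (f ∘ suc) k))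
    (sym (^-distribʳ-* k (f zero) (prod (f ∘ suc))))

^-sum : ∀ {n} x (e : Vector ℕ n) → prod (λ i → x ^ e i) ≡ x ^ sum e
^-sum {zero}  x e = refl
^-sum {suc n} x e = trans (cong (x ^ e zero *_) (^-sum x (e ∘ suc)))
    (sym (^-distribˡ-+-* x (e zero) (sum (e ∘ suc))))

prod-one : ∀ {n} {f : Vector ℕ n} → (∀ i → f i ≡ 1) → prod f ≡ 1
prod-one {zero}  f≡1 = refl
prod-one {suc n} f≡1 = cong₂ _*_ (f≡1 zero) (prod-one (f≡1 ∘ suc))

prod≢0 : ∀ {n} {f : Vector ℕ n} → (∀ i → NonZero (f i)) → NonZero (prod f)
prod≢0 {zero}  f≢0 = _
prod≢0 {suc n} {f} f≢0 = m*n≢0 (f zero) _ {{f≢0 zero}} {{prod≢0 (f≢0 ∘ suc)}}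

sum-zero : ∀ {n} {f : Vector ℕ n} → (∀ i → f i ≡ 0) → sum f ≡ 0
sum-zero {n} f≡0 = trans (sum-cong-≗ f≡0) (sum-replicate-zero n)

sum≡0⇒ : ∀ {n} (f : Vector ℕ n) → sum f ≡ 0 → ∀ i → f i ≡ 0
sum≡0⇒ f eq zero    = m+n≡0⇒m≡0 (f zero) eq
sum≡0⇒ f eq (suc i) = sum≡0⇒ (f ∘ suc) (m+n≡0⇒n≡0 (f zero) eq) i

sum-≤1 : ∀ {n} (f : Vector ℕ n) → (∀ i → f i ≤ 1) → sum f ≤ n
sum-≤1 {zero}  f f≤1 = z≤n
sum-≤1 {suc n} f f≤1 = +-mono-≤ (f≤1 zero) (sum-≤1 (f ∘ suc) (f≤1 ∘ suc))

∑-ne : ∀ {n} (u : Fin n) (g : Fin n → ℕ) → sum (λ w → ne u w * g w) + g u ≡ sum g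
∑-ne u g = begin
  sum (λ w → ne u w * g w) + g u                         ≡⟨ cong (sum (λ w → ne u w * g w) +_) (∑-δ u g) ⟨
  sum (λ w → ne u w * g w) + sum (λ w → δ u w * g w)     ≡⟨ ∑-distrib-+ (λ w → ne u w * g w)
      (λ w → δ u w * g w) ⟨
  sum (λ w → ne u w * g w + δ u w * g w)                 ≡⟨ sum-cong-≗ split ⟩
  sum g                                                  ∎
  where
  open ≡-Reasoning
  split : ∀ w → ne u w * g w + δ u w * g w ≡ g w
  split w with u Fin.≟ w
  ... | yes _ = *-identityˡ (g w)
  ... | no  _ = trans (+-identityʳ _) (*-identityˡ (g w))

∑-∖∖ : ∀ {n} S {v w : Fin n} → S v ≡ true → S w ≡ true → v ≢ w → ∀ (g : Fin n → ℕ) →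
  sum (λ x → χ ((S ∖ v ∖ w) x) * g x) + g v + g w ≡ sum (λ x → χ (S x) * g x)
∑-∖∖ S {v} {w} Sv Sw v≢w g = begin
  sum (λ x → χ ((S ∖ v ∖ w) x) * g x) + g v + g w
    ≡⟨ cong₂ (λ p q → p + q + g w) (sum-cong-≗ λ x → trans (cong (_* g x) (χ-∖∖ S v w x))
        (reorder (χ (S x)) (g x) (ne-sym x v) (ne-sym x w))) (sym gv) ⟩
  sum (λ x → ne v x * (ne w x * (χ (S x) * g x))) + ne w v * (χ (S v) * g v) + g w
    ≡⟨ cong (_+ g w) (∑-ne v (λ x → ne w x * (χ (S x) * g x))) ⟩
  sum (λ x → ne w x * (χ (S x) * g x)) + g w
    ≡⟨ cong (sum (λ x → ne w x * (χ (S x) * g x)) +_) (trans (cong (λ b → χ b * g w) Sw) (*-identityˡ (g w))) ⟨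
  sum (λ x → ne w x * (χ (S x) * g x)) + χ (S w) * g w
    ≡⟨ ∑-ne w (λ x → χ (S x) * g x) ⟩
  sum (λ x → χ (S x) * g x) ∎
  where
  open ≡-Reasoning
  gv : ne w v * (χ (S v) * g v) ≡ g v
  gv = trans (cong₂ (λ p b → p * (χ b * g v)) (ne-≢ (v≢w ∘ sym)) Sv) (trans (*-identityˡ _) (*-identityˡ _))
  reorder : ∀ s y {p p′ q q′} → p ≡ p′ → q ≡ q′ → s * p * q * y ≡ p′ * (q′ * (s * y))
  reorder s y {p} {_} {q} refl refl = go s p q y
    where
    go : ∀ s p q y → s * p * q * y ≡ p * (q * (s * y))
    go = solve-∀

-- `G d` stands for g(d) ^ `L` and is known only through its `d`-th power. At `d` = 0 that equation
-- reads 1 = 1, so the convention for degree 0 enters separately as `G-zero`.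
module Induction {N : ℕ} (A : Matrix N) (A-01 : Is01 A) (A-sym : IsSymmetric A) (A-diag : ZeroDiagonal A)
  (L : ℕ) .{{_ : NonZero L}} (G : ℕ → ℕ) (G-zero : G 0 ≡ 0)
  (G-^ : ∀ d → d ≤ N → G d ^ d ≡ (d !) ^ L) where

  h : VertexSet N → ℕ
  h = haf A (pairs N)

  deg : VertexSet N → Fin N → ℕ
  deg S u = sum (λ w → χ (S w) * A u w)

  -- The exponent `χ (S u)` turns the factors outside `S` into 1, even where `G` is 0.
  Bound : VertexSet N → Set
  Bound S = h S ^ (2 * L) ≤ prod (λ u → G (deg S u) ^ χ (S u))

  A≤1 : ∀ u w → A u w ≤ 1
  A≤1 u w with A-01 u w
  ... | inj₁ eq rewrite eq = z≤n
  ... | inj₂ eq rewrite eq = ≤-refl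

  deg≤N : ∀ S u → deg S u ≤ N
  deg≤N S u = sum-≤1 (λ w → χ (S w) * A u w) (λ w → *-mono-≤ (χ≤1 (S w)) (A≤1 u w))
    where
    χ≤1 : ∀ b → χ b ≤ 1
    χ≤1 true  = ≤-refl
    χ≤1 false = z≤n

  G≢0 : ∀ d → suc d ≤ N → NonZero (G (suc d))
  G≢0 d d<N with G (suc d) | G-^ (suc d) d<N
  ... | suc _ | _  = _
  ... | zero  | eq = contradiction (m^n≡0⇒m≡0 (suc d !) L (sym eq)) (≢-nonZero⁻¹ (suc d !) {{suc d !≢0}})

  G-log-concave : ∀ d → 2 + d ≤ N → G d * G (2 + d) ≤ G (1 + d) * G (1 + d)
  G-log-concave zero    _   rewrite G-zero = z≤n
  G-log-concave (suc k) d≤N = root-log-concave k L {G (1 + k)} {G (3 + k)} {G (2 + k)}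
    (G-^ (suc k) (≤-trans (n≤1+n _) (≤-trans (n≤1+n _) d≤N))) (G-^ (2 + k) (≤-trans (n≤1+n _) d≤N))
        (G-^ (3 + k) d≤N)

  -- With e = d + a + b this is g(e-a-b) ≤ g(e) (g(e-1) / g(e)) ^ (a+b), denominators cleared. It is
  -- an equality for a + b ≤ 1; the case a + b = 2 is log-concavity.
  G-step : ∀ d a b → a ≡ 0 ⊎ a ≡ 1 → b ≡ 0 ⊎ b ≡ 1 → d + a + b ≤ N →
    G d * G (d + a + b) ^ (a + b) ≤ G (d + a + b) * G (pred (d + a + b)) ^ (a + b)
  G-step d _ _ (inj₁ refl) (inj₁ refl) _ rewrite +-identityʳ d | +-identityʳ d = ≤-refl
  G-step d _ _ (inj₁ refl) (inj₂ refl) _ rewrite +-identityʳ d | +-comm d 1 = ≤-reflexive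
      (swap (G d) (G (suc d)))
    where
    swap : ∀ x y → x * (y * 1) ≡ y * (x * 1)
    swap = solve-∀
  G-step d _ _ (inj₂ refl) (inj₁ refl) _ rewrite +-identityʳ (d + 1) | +-comm d 1 = ≤-reflexive
      (swap (G d) (G (suc d)))
    where
    swap : ∀ x y → x * (y * 1) ≡ y * (x * 1)
    swap = solve-∀
  G-step d _ _ (inj₂ refl) (inj₂ refl) d≤N rewrite +-assoc d 1 1 | +-comm d 2 = begin
    G d * (G (2 + d) * (G (2 + d) * 1))          ≡⟨ lhs (G d) (G (2 + d)) ⟩
    G (2 + d) * (G d * G (2 + d))                ≤⟨ *-monoʳ-≤ (G (2 + d)) (G-log-concave d d≤N) ⟩
    G (2 + d) * (G (1 + d) * G (1 + d))          ≡⟨ rhs (G (1 + d)) (G (2 + d)) ⟩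
    G (2 + d) * (G (1 + d) * (G (1 + d) * 1))    ∎
    where
    open ≤-Reasoning
    lhs : ∀ x z → x * (z * (z * 1)) ≡ z * (x * z)
    lhs = solve-∀
    rhs : ∀ y z → z * (y * y) ≡ z * (y * (y * 1))
    rhs = solve-∀

  module Step (S : VertexSet N) where

    F m : ℕ
    F = h S
    m = sum (χ ∘ S)

    c : Fin N → Fin N → ℕ
    c v w = removal A (pairs N) S (v , w)

    c-sym : ∀ v w → c v w ≡ c w v
    c-sym = removal-sym A A-sym (pairs N) S

    c-row : ∀ v → sum (c v) ≡ χ (S v) * F
    c-row v with S v in Sv
    ... | true  = sym (trans (+-identityʳ F)
        (trans (haf-row A A-sym A-diag S Sv) (sum-cong-≗ λ w → cong
        (λ b → χ b * χ (S w) * (A v w * h (S ∖ v ∖ w))) Sv)))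
    ... | false = sum-zero {f = λ w → 0 * χ (S w) * (A v w * h (S ∖ v ∖ w))} (λ w → refl)

    c-col : ∀ u → sum (λ v → c v u) ≡ χ (S u) * F
    c-col u = trans (sum-cong-≗ (λ v → c-sym v u)) (c-row u)

    A*c : ∀ v w → A v w * c v w ≡ c v w
    A*c v w with A v w | A-01 v w
    ... | _ | inj₁ refl = sym (*-zeroʳ (χ (S v) * χ (S w)))
    ... | _ | inj₂ refl = *-identityˡ _

    c-diag : ∀ u → c u u ≡ 0
    c-diag u = trans (sym (A*c u u)) (cong (_* c u u) (A-diag u))

    c≢0 : ∀ v w → c v w ≡ 0 ⊎ (S v ≡ true × S w ≡ true × v ≢ w × c v w ≡ h (S ∖ v ∖ w))
    c≢0 v w with S v | S w | A-01 v w
    ... | false | _     | _       = inj₁ refl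
    ... | true  | false | _       = inj₁ refl
    ... | true  | true  | inj₁ eq = inj₁ (cong (λ a → 1 * (a * h (S ∖ v ∖ w))) eq)
    ... | true  | true  | inj₂ eq = inj₂ (refl , refl ,
      (λ { refl → 0≢1+n (trans (sym (A-diag v)) eq) }) ,
      trans (cong (λ a → 1 * (a * h (S ∖ v ∖ w))) eq) (trans (*-identityˡ _) (*-identityˡ _)))

    -- This is `log-sum` for the indicator of the neighbours of `v` in `S` against the row `c v`.
    -- The product of the powers of the indicator is 1, since `c v w` = 0 wherever the indicator
    -- vanishes and 0 ^ 0 = 1. For `v` outside `S` all exponents are 0.
    entropy : ∀ v → F ^ (χ (S v) * F) ≤ prod (λ w → c v w ^ c v w) * deg S v ^ (χ (S v) * F)
    entropy v = begin
      F ^ (χ (S v) * F)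
        ≡⟨ selfpower (S v) ⟩
      (χ (S v) * F) ^ (χ (S v) * F)
        ≡⟨ *-identityˡ _ ⟨
      1 * (χ (S v) * F) ^ (χ (S v) * F)
        ≡⟨ cong (_* (χ (S v) * F) ^ (χ (S v) * F)) (prod-one unit) ⟨
      prod (λ w → (χ (S w) * A v w) ^ c v w) * (χ (S v) * F) ^ (χ (S v) * F)
        ≤⟨ subst (λ Q → prod (λ w → (χ (S w) * A v w) ^ c v w) * Q ^ Q ≤ prod (λ w → c v w ^ c v w) * deg S
            v ^ Q)
             (c-row v) (log-sum (λ w → χ (S w) * A v w) (c v)) ⟩
      prod (λ w → c v w ^ c v w) * deg S v ^ (χ (S v) * F) ∎
      where
      open ≤-Reasoning
      selfpower : ∀ b → F ^ (χ b * F) ≡ (χ b * F) ^ (χ b * F)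
      selfpower true  = cong (_^ (1 * F)) (sym (*-identityˡ F))
      selfpower false = refl
      unit : ∀ w → (χ (S w) * A v w) ^ c v w ≡ 1
      unit w with S w | A-01 v w
      ... | false | _       = cong (λ s → 0 ^ (s * (A v w * h (S ∖ v ∖ w)))) (*-zeroʳ (χ (S v)))
      ... | true  | inj₁ eq rewrite eq = cong (0 ^_) (*-zeroʳ (χ (S v) * 1))
      ... | true  | inj₂ eq rewrite eq = ^-zeroˡ (χ (S v) * 1 * (1 * h (S ∖ v ∖ w)))

    E : Fin N → Fin N → Fin N → ℕ
    E v w u = χ ((S ∖ v ∖ w) u)

    -- T counts the triples in which u survives the removal of v and w; K weights them by the drop of deg u.
    K T : Fin N → ℕ
    K u = sum (λ v → sum (λ w → c v w * (E v w u * (A u v + A u w))))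
    T u = sum (λ v → sum (λ w → c v w * E v w u))

    row-ne : ∀ u v → sum (λ w → ne u w * c v w) + c v u ≡ χ (S v) * F
    row-ne u v = trans (∑-ne u (c v)) (c-row v)

    -- For `u` in `S`: the matrix `c` has total weight `m * F`. Discarding the pairs that involve
    -- `u` removes row `u` and column `u`, each of weight `F`, and these overlap only in `c u u` =
    -- 0.
    T-count : ∀ u b → S u ≡ b → T u + 2 * (χ b * F) ≡ χ b * (m * F)
    T-count u false Su = trans (+-identityʳ (T u)) (sum-zero λ v → sum-zero λ w →
      trans (cong (c v w *_) (trans (χ-∖∖ S v w u) (cong (λ b → χ b * ne u v * ne u w) Su))) (*-zeroʳ (c v w)))
    T-count u true  Su = begin
      T u + 2 * (1 * F)
        ≡⟨ cong₂ _+_ (sum-cong-≗ λ v → trans (sum-cong-≗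
            (λ w → trans (cong (c v w *_) (trans (χ-∖∖ S v w u) (cong (λ b → χ b * ne u v * ne u w) Su)))
            (pull (c v w) (ne u v) (ne u w)))) (sym (*-distribˡ-sum (ne u v) (λ w → ne u w * c v w))))
            (double F) ⟩
      sum (λ v → ne u v * r v) + (F + F)
        ≡⟨ +-assoc (sum (λ v → ne u v * r v)) F F ⟨
      sum (λ v → ne u v * r v) + F + F
        ≡⟨ cong (λ t → sum (λ v → ne u v * r v) + t + F) column ⟨
      sum (λ v → ne u v * r v) + sum (λ v → ne u v * c v u) + F
        ≡⟨ cong (_+ F) (∑-distrib-+ (λ v → ne u v * r v) (λ v → ne u v * c v u)) ⟨
      sum (λ v → ne u v * r v + ne u v * c v u) + F
        ≡⟨ cong₂ _+_ (sum-cong-≗ λ v → trans (sym (*-distribˡ-+ (ne u v) (r v) (c v u)))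
            (cong (ne u v *_) (row-ne u v))) (trans (sym (*-identityˡ F)) (cong (λ b → χ b * F) (sym Su))) ⟩
      sum (λ v → ne u v * (χ (S v) * F)) + χ (S u) * F
        ≡⟨ ∑-ne u (λ v → χ (S v) * F) ⟩
      sum (λ v → χ (S v) * F)
        ≡⟨ *-distribʳ-sum F (χ ∘ S) ⟨
      m * F
        ≡⟨ *-identityˡ (m * F) ⟨
      1 * (m * F) ∎
      where
      open ≡-Reasoning
      r : Fin N → ℕ
      r v = sum (λ w → ne u w * c v w)
      pull : ∀ x p q → x * (1 * p * q) ≡ p * (q * x)
      pull = solve-∀
      double : ∀ x → 2 * (1 * x) ≡ x + x
      double = solve-∀
      column : sum (λ v → ne u v * c v u) ≡ F
      column = begin
        sum (λ v → ne u v * c v u)           ≡⟨ +-identityʳ _ ⟨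
        sum (λ v → ne u v * c v u) + 0       ≡⟨ cong (sum (λ v → ne u v * c v u) +_) (c-diag u) ⟨
        sum (λ v → ne u v * c v u) + c u u   ≡⟨ trans (∑-ne u (λ v → c v u)) (c-col u) ⟩
        χ (S u) * F                          ≡⟨ trans (cong (λ b → χ b * F) Su) (*-identityˡ F) ⟩
        F                                    ∎

    -- For `u` in `S`: by symmetry `K u` is twice `H`, the weight of the pairs (v , w) with `v`
    -- adjacent to `u` and `w` different from `u`. The rows of the neighbours of `u` have total
    -- weight `deg S u * F`, and their entries in column `u`, which `H` omits, add up to `F`.
    K-count : ∀ u b → S u ≡ b → K u + 2 * (χ b * F) ≡ 2 * (deg S u * (χ b * F))
    K-count u false Su = trans (+-identityʳ (K u)) (trans (sum-zero λ v → sum-zero λ w →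
      trans (cong (λ e → c v w * (e * (A u v + A u w)))
          (trans (χ-∖∖ S v w u) (cong (λ b → χ b * ne u v * ne u w) Su))) (*-zeroʳ (c v w)))
      (sym (cong (2 *_) (*-zeroʳ (deg S u)))))
    K-count u true  Su = begin
      K u + 2 * (1 * F)
        ≡⟨ cong (_+ 2 * (1 * F)) K≡2H ⟩
      H + H + 2 * (1 * F)
        ≡⟨ double H F ⟩
      2 * (H + F)
        ≡⟨ cong (2 *_) H-count ⟩
      2 * (deg S u * F)
        ≡⟨ cong (λ t → 2 * (deg S u * t)) (*-identityˡ F) ⟨
      2 * (deg S u * (1 * F)) ∎
      where
      open ≡-Reasoning
      double : ∀ h f → h + h + 2 * (1 * f) ≡ 2 * (h + f)
      double = solve-∀
      r : Fin N → ℕ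
      r v = sum (λ w → ne u w * c v w)
      H₁ H₂ : Fin N → Fin N → ℕ
      H₁ v w = A u v * (ne u w * c v w)
      H₂ v w = A u w * (ne u v * c w v)
      H : ℕ
      H = sum (λ v → sum (H₁ v))
      ne*A : ∀ v → ne u v * A u v ≡ A u v
      ne*A v with u Fin.≟ v
      ... | yes refl = sym (A-diag u)
      ... | no _     = *-identityˡ (A u v)
      split : ∀ v w → c v w * (E v w u * (A u v + A u w)) ≡ H₁ v w + H₂ v w
      split v w = begin
        c v w * (E v w u * (A u v + A u w))
          ≡⟨ cong (λ e → c v w * (e * (A u v + A u w)))
              (trans (χ-∖∖ S v w u) (cong (λ b → χ b * ne u v * ne u w) Su)) ⟩
        c v w * (1 * ne u v * ne u w * (A u v + A u w))
          ≡⟨ expand (c v w) (ne u v) (ne u w) (A u v) (A u w) ⟩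
        ne u v * A u v * (ne u w * c v w) + ne u w * A u w * (ne u v * c v w)
          ≡⟨ cong₂ _+_ (cong (_* (ne u w * c v w)) (ne*A v))
              (cong₂ (λ a x → a * (ne u v * x)) (ne*A w) (c-sym v w)) ⟩
        H₁ v w + H₂ v w ∎
        where
        expand : ∀ x p q a b → x * (1 * p * q * (a + b)) ≡ p * a * (q * x) + q * b * (p * x)
        expand = solve-∀
      K≡2H : K u ≡ H + H
      K≡2H = begin
        K u                                             ≡⟨ sum-cong-≗
            (λ v → trans (sum-cong-≗ (split v)) (∑-distrib-+ (H₁ v) (H₂ v))) ⟩
        sum (λ v → sum (H₁ v) + sum (H₂ v))             ≡⟨ ∑-distrib-+ (λ v → sum (H₁ v)) (λ v → sum (H₂ v)) ⟩
        H + sum (λ v → sum (λ w → H₁ w v))              ≡⟨ cong (H +_) (∑-comm (λ v w → H₁ w v)) ⟩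
        H + H                                           ∎
      H-count : H + F ≡ deg S u * F
      H-count = begin
        H + F
          ≡⟨ cong₂ _+_ (sum-cong-≗ (λ v → sym (*-distribˡ-sum (A u v) (λ w → ne u w * c v w))))
              (sym (trans (c-col u) (trans (cong (λ b → χ b * F) Su) (*-identityˡ F)))) ⟩
        sum (λ v → A u v * r v) + sum (λ v → c v u)
          ≡⟨ ∑-distrib-+ (λ v → A u v * r v) (λ v → c v u) ⟨
        sum (λ v → A u v * r v + c v u)
          ≡⟨ sum-cong-≗ (λ v → cong (A u v * r v +_)
              (trans (c-sym v u) (trans (sym (A*c u v)) (cong (A u v *_) (c-sym u v))))) ⟩
        sum (λ v → A u v * r v + A u v * c v u)
          ≡⟨ sum-cong-≗ (λ v → trans (sym (*-distribˡ-+ (A u v) (r v) (c v u)))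
              (trans (cong (A u v *_) (row-ne u v)) (regroup (A u v) (χ (S v)) F))) ⟩
        sum (λ v → χ (S v) * A u v * F)
          ≡⟨ *-distribʳ-sum F (λ v → χ (S v) * A u v) ⟨
        deg S u * F ∎
        where
        regroup : ∀ a s f → a * (s * f) ≡ s * a * f
        regroup = solve-∀

    IH : Set
    IH = ∀ v w → S v ≡ true → S w ≡ true → v ≢ w → Bound (S ∖ v ∖ w)

    module _ (ih : IH) where

      α : Fin N → Fin N → Fin N → ℕ
      α v w u = A u v + A u w

      deg-∖∖ : ∀ {v w} → S v ≡ true → S w ≡ true → v ≢ w → ∀ u →
        deg (S ∖ v ∖ w) u + A u v + A u w ≡ deg S u
      deg-∖∖ Sv Sw v≢w u = ∑-∖∖ S Sv Sw v≢w (A u)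

      -- The induction hypothesis for the set without `v` and `w`, raised to the power `c v w`, with
      -- each new degree traded for the old one by `G-step`. If `c v w` = 0, every exponent
      -- vanishes.
      local : ∀ v w → (c v w ^ c v w) ^ (2 * L) * prod (λ u → G (deg S u) ^ (c v w * (E v w u * α v w u))) ≤
        prod (λ u → G (deg S u) ^ (c v w * E v w u) * G (pred (deg S u)) ^ (c v w * (E v w u * α v w u)))
      local v w with c v w | c≢0 v w
      ... | _ | inj₁ refl = ≤-reflexive (trans
        (cong₂ _*_ (^-zeroˡ (2 * L)) (prod-one {N} {λ _ → 1} (λ _ → refl)))
            (sym (prod-one {N} {λ _ → 1} (λ _ → refl))))
      ... | _ | inj₂ (Sv , Sw , v≢w , refl) = begin
        (x ^ x) ^ (2 * L) * prod (λ u → G (deg S u) ^ (x * (E v w u * α v w u)))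
          ≡⟨ cong₂ _*_ (power-swap x x (2 * L)) (trans
              (prod-cong-≗ λ u → power-pull (G (deg S u)) x (E v w u * α v w u))
              (prod-^ (λ u → G (deg S u) ^ (E v w u * α v w u)) x)) ⟩
        (x ^ (2 * L)) ^ x * prod (λ u → G (deg S u) ^ (E v w u * α v w u)) ^ x
          ≡⟨ ^-distribʳ-* x (x ^ (2 * L)) _ ⟨
        (x ^ (2 * L) * prod (λ u → G (deg S u) ^ (E v w u * α v w u))) ^ x
          ≤⟨ ^-monoˡ-≤ x (begin
            x ^ (2 * L) * prod (λ u → G (deg S u) ^ (E v w u * α v w u))
              ≤⟨ *-monoˡ-≤ _ (ih v w Sv Sw v≢w) ⟩
            prod (λ u → G (deg (S ∖ v ∖ w) u) ^ E v w u) * prod (λ u → G (deg S u) ^ (E v w u * α v w u))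
              ≡⟨ ∏-distrib-* (λ u → G (deg (S ∖ v ∖ w) u) ^ E v w u) (λ u → G (deg S u) ^ (E v w u * α v w u)) ⟨
            prod (λ u → G (deg (S ∖ v ∖ w) u) ^ E v w u * G (deg S u) ^ (E v w u * α v w u))
              ≤⟨ prod-mono-≤ (λ u → factor u ((S ∖ v ∖ w) u)) ⟩
            prod (λ u → G (deg S u) ^ E v w u * G (pred (deg S u)) ^ (E v w u * α v w u)) ∎) ⟩
        prod (λ u → G (deg S u) ^ E v w u * G (pred (deg S u)) ^ (E v w u * α v w u)) ^ x
          ≡⟨ prod-^ (λ u → G (deg S u) ^ E v w u * G (pred (deg S u)) ^ (E v w u * α v w u)) x ⟨
        prod (λ u → (G (deg S u) ^ E v w u * G (pred (deg S u)) ^ (E v w u * α v w u)) ^ x)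
          ≡⟨ prod-cong-≗ (λ u → trans (^-distribʳ-* x (G (deg S u) ^ E v w u) _)
               (sym (cong₂ _*_ (power-pull (G (deg S u)) x (E v w u))
                   (power-pull (G (pred (deg S u))) x (E v w u * α v w u))))) ⟩
        prod (λ u → G (deg S u) ^ (x * E v w u) * G (pred (deg S u)) ^ (x * (E v w u * α v w u))) ∎
        where
        open ≤-Reasoning
        x : ℕ
        x = h (S ∖ v ∖ w)
        power-swap : ∀ b p q → (b ^ p) ^ q ≡ (b ^ q) ^ p
        power-swap b p q = trans (^-*-assoc b p q) (trans (cong (b ^_) (*-comm p q)) (sym (^-*-assoc b q p)))
        power-pull : ∀ b p q → b ^ (p * q) ≡ (b ^ q) ^ p
        power-pull b p q = trans (cong (b ^_) (*-comm p q)) (sym (^-*-assoc b q p))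
        -- If `u` is not in the remaining set (`e` = `false`), both sides are 1; otherwise its
        -- degree drops by exactly `α v w u`.
        factor : ∀ u e → G (deg (S ∖ v ∖ w) u) ^ χ e * G (deg S u) ^ (χ e * α v w u) ≤
          G (deg S u) ^ χ e * G (pred (deg S u)) ^ (χ e * α v w u)
        factor u false = ≤-refl
        factor u true  = subst (λ d → G (deg (S ∖ v ∖ w) u) ^ 1 * G d ^ (1 * α v w u) ≤ G d ^ 1 * G (pred d) ^
            (1 * α v w u))
          (deg-∖∖ Sv Sw v≢w u)
          (subst₂ _≤_ (cong₂ _*_ (unit (G d′)) (cong (G d ^_) (sym (*-identityˡ (α v w u)))))
              (cong₂ _*_ (unit (G d)) (cong (G (pred d) ^_) (sym (*-identityˡ (α v w u)))))
            (G-step d′ (A u v) (A u w) (A-01 u v) (A-01 u w)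
                (subst (_≤ N) (sym (deg-∖∖ Sv Sw v≢w u)) (deg≤N S u))))
          where
          d′ d : ℕ
          d′ = deg (S ∖ v ∖ w) u
          d = d′ + A u v + A u w
          unit : ∀ y → y ≡ y ^ 1
          unit y = sym (*-identityʳ y)

      -- The exponential of the sum of all c log c. It links the two halves: `entropies` bounds `F`
      -- in terms of `W`, `global` bounds `W` by the induction hypothesis, and `bound` eliminates
      -- it.
      W : ℕ
      W = prod (λ v → prod (λ w → c v w ^ c v w))

      collect : ∀ (X : Fin N → ℕ) (e : Fin N → Fin N → Fin N → ℕ) →
        prod (λ v → prod (λ w → prod (λ u → X u ^ e v w u))) ≡ prod
            (λ u → X u ^ sum (λ v → sum (λ w → e v w u)))
      collect X e = begin
        prod (λ v → prod (λ w → prod (λ u → X u ^ e v w u)))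
          ≡⟨ prod-cong-≗ (λ v → trans (∏-comm (λ w u → X u ^ e v w u))
              (prod-cong-≗ (λ u → ^-sum (X u) (λ w → e v w u)))) ⟩
        prod (λ v → prod (λ u → X u ^ sum (λ w → e v w u)))
          ≡⟨ ∏-comm (λ v u → X u ^ sum (λ w → e v w u)) ⟩
        prod (λ u → prod (λ v → X u ^ sum (λ w → e v w u)))
          ≡⟨ prod-cong-≗ (λ u → ^-sum (X u) (λ v → sum (λ w → e v w u))) ⟩
        prod (λ u → X u ^ sum (λ v → sum (λ w → e v w u))) ∎
        where open ≡-Reasoning

      prod² : (Fin N → Fin N → ℕ) → ℕ
      prod² f = prod (λ v → prod (f v))

      prod²-* : ∀ f g → prod² (λ v w → f v w * g v w) ≡ prod² f * prod² g
      prod²-* f g = trans (prod-cong-≗ (λ v → ∏-distrib-* (f v) (g v)))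
          (∏-distrib-* (λ v → prod (f v)) (λ v → prod (g v)))

      global : W ^ (2 * L) * prod (λ u → G (deg S u) ^ K u) ≤
        prod (λ u → G (deg S u) ^ T u) * prod (λ u → G (pred (deg S u)) ^ K u)
      global = begin
        W ^ (2 * L) * prod (λ u → G (deg S u) ^ K u)
          ≡⟨ cong₂ _*_ (trans (prod-cong-≗ (λ v → prod-^ (λ w → c v w ^ c v w) (2 * L)))
              (prod-^ (λ v → prod (λ w → c v w ^ c v w)) (2 * L)))
               (collect (G ∘ deg S) eK) ⟨
        prod² (λ v w → (c v w ^ c v w) ^ (2 * L)) * prod² (λ v w → prod (λ u → G (deg S u) ^ eK v w u))
          ≡⟨ prod²-* (λ v w → (c v w ^ c v w) ^ (2 * L)) (λ v w → prod (λ u → G (deg S u) ^ eK v w u)) ⟨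
        prod² (λ v w → (c v w ^ c v w) ^ (2 * L) * prod (λ u → G (deg S u) ^ eK v w u))
          ≤⟨ prod-mono-≤ (λ v → prod-mono-≤ (local v)) ⟩
        prod² (λ v w → prod (λ u → G (deg S u) ^ eT v w u * G (pred (deg S u)) ^ eK v w u))
          ≡⟨ prod-cong-≗ (λ v → prod-cong-≗ (λ w → ∏-distrib-* (λ u → G (deg S u) ^ eT v w u)
              (λ u → G (pred (deg S u)) ^ eK v w u))) ⟩
        prod² (λ v w → prod (λ u → G (deg S u) ^ eT v w u) * prod (λ u → G (pred (deg S u)) ^ eK v w u))
          ≡⟨ prod²-* (λ v w → prod (λ u → G (deg S u) ^ eT v w u))
              (λ v w → prod (λ u → G (pred (deg S u)) ^ eK v w u)) ⟩
        prod² (λ v w → prod (λ u → G (deg S u) ^ eT v w u)) * prod²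
            (λ v w → prod (λ u → G (pred (deg S u)) ^ eK v w u))
          ≡⟨ cong₂ _*_ (collect (G ∘ deg S) eT) (collect (G ∘ pred ∘ deg S) eK) ⟩
        prod (λ u → G (deg S u) ^ T u) * prod (λ u → G (pred (deg S u)) ^ K u) ∎
        where
        open ≤-Reasoning
        eT eK : Fin N → Fin N → Fin N → ℕ
        eT v w u = c v w * E v w u
        eK v w u = c v w * (E v w u * α v w u)

      entropies : F ^ (m * F) ≤ W * prod (λ v → deg S v ^ (χ (S v) * F))
      entropies = begin
        F ^ (m * F)                                  ≡⟨ cong (F ^_) (*-distribʳ-sum F (χ ∘ S)) ⟩
        F ^ sum (λ v → χ (S v) * F)                  ≡⟨ ^-sum F (λ v → χ (S v) * F) ⟨
        prod (λ v → F ^ (χ (S v) * F))               ≤⟨ prod-mono-≤ entropy ⟩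
        prod (λ v → prod (λ w → c v w ^ c v w) * deg S v ^ (χ (S v) * F))
          ≡⟨ ∏-distrib-* (λ v → prod (λ w → c v w ^ c v w)) (λ v → deg S v ^ (χ (S v) * F)) ⟩
        W * prod (λ v → deg S v ^ (χ (S v) * F))     ∎
        where open ≤-Reasoning

      -- For a vertex in `S` the two counts say T = (m-2) F and K = 2 (d-1) F. Hence d ^ (2LF) and G
      -- (d-1) ^ K combine to (d !) ^ (2LF) = G d ^ (2dF), and 2dF + T = mF + K.
      balance : .{{_ : NonZero F}} → ∀ d s T K → d ≤ N → T + 2 * (χ s * F) ≡ χ s * (m * F) →
        K + 2 * (χ s * F) ≡ 2 * (d * (χ s * F)) →
        (d ^ (χ s * F)) ^ (2 * L) * (G d ^ T * G (pred d) ^ K) ≡ (G d ^ χ s) ^ (m * F) * G d ^ K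
      balance d false T K _ eT eK
        rewrite m+n≡0⇒m≡0 T eT | m+n≡0⇒m≡0 K (trans eK (cong (2 *_) (*-zeroʳ d))) =
        trans (cong (_* 1) (^-zeroˡ (2 * L))) (cong (_* 1) (sym (^-zeroˡ (m * F))))
      -- A vertex of degree 0 in `S` would force K + 2F = 0, although `F` is nonzero.
      balance zero true T K _ eT eK =
        contradiction (m+n≡0⇒m≡0 F (m+n≡0⇒m≡0 (1 * F) (m+n≡0⇒n≡0 K eK))) (≢-nonZero⁻¹ F)
      balance d@(suc d′) true T K d≤N eT eK = begin
        (d ^ (1 * F)) ^ (2 * L) * (G d ^ T * G d′ ^ K)
          ≡⟨ cong₂ (λ p q → p * (G d ^ T * q)) (trans (^-*-assoc d (1 * F) (2 * L))
              (trans (cong (d ^_) (ex₁ F L)) (sym (^-*-assoc d L (2 * F)))))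
               (trans (cong (G d′ ^_) K≡) (trans (sym (^-*-assoc (G d′) d′ (2 * F)))
                   (cong (_^ (2 * F)) (G-^ d′ (≤-trans (n≤1+n d′) d≤N))))) ⟩
        (d ^ L) ^ (2 * F) * (G d ^ T * ((d′ !) ^ L) ^ (2 * F))
          ≡⟨ regroup ((d ^ L) ^ (2 * F)) (G d ^ T) (((d′ !) ^ L) ^ (2 * F)) ⟩
        (d ^ L) ^ (2 * F) * ((d′ !) ^ L) ^ (2 * F) * G d ^ T
          ≡⟨ cong (_* G d ^ T) (trans (sym (^-distribʳ-* (2 * F) (d ^ L) ((d′ !) ^ L)))
              (cong (_^ (2 * F)) (trans (sym (^-distribʳ-* L d (d′ !))) (sym (G-^ d d≤N))))) ⟩
        (G d ^ d) ^ (2 * F) * G d ^ T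
          ≡⟨ trans (cong (_* G d ^ T) (^-*-assoc (G d) d (2 * F)))
              (sym (^-distribˡ-+-* (G d) (d * (2 * F)) T)) ⟩
        G d ^ (d * (2 * F) + T)
          ≡⟨ cong (G d ^_) exponents ⟩
        G d ^ (m * F + K)
          ≡⟨ ^-distribˡ-+-* (G d) (m * F) K ⟩
        G d ^ (m * F) * G d ^ K
          ≡⟨ cong (λ g → g ^ (m * F) * G d ^ K) (*-identityʳ (G d)) ⟨
        (G d ^ 1) ^ (m * F) * G d ^ K ∎
        where
        open ≡-Reasoning
        ex₁ : ∀ F L → 1 * F * (2 * L) ≡ L * (2 * F)
        ex₁ = solve-∀
        regroup : ∀ a b c → a * (b * c) ≡ a * c * b
        regroup = solve-∀
        K≡ : K ≡ d′ * (2 * F)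
        K≡ = +-cancelʳ-≡ (2 * (1 * F)) K (d′ * (2 * F)) (trans eK (ex₂ d′ F))
          where
          ex₂ : ∀ d′ F → 2 * (suc d′ * (1 * F)) ≡ d′ * (2 * F) + 2 * (1 * F)
          ex₂ = solve-∀
        exponents : d * (2 * F) + T ≡ m * F + K
        exponents = begin
          d * (2 * F) + T                  ≡⟨ ex₃ d F T ⟩
          2 * (d * (1 * F)) + T            ≡⟨ cong (_+ T) eK ⟨
          K + 2 * (1 * F) + T              ≡⟨ ex₄ K F T ⟩
          T + 2 * (1 * F) + K              ≡⟨ cong (_+ K) eT ⟩
          1 * (m * F) + K                  ≡⟨ cong (_+ K) (*-identityˡ (m * F)) ⟩
          m * F + K                        ∎
          where
          ex₃ : ∀ d F T → d * (2 * F) + T ≡ 2 * (d * (1 * F)) + T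
          ex₃ = solve-∀
          ex₄ : ∀ K F T → K + 2 * (1 * F) + T ≡ T + 2 * (1 * F) + K
          ex₄ = solve-∀

      -- This allows `G d ^ K` to be cancelled although `G 0` = 0: at degree 0 the count forces `K`
      -- = 0, and the power is 1.
      G^K≢0 : ∀ d s K → d ≤ N → K + 2 * (χ s * F) ≡ 2 * (d * (χ s * F)) → NonZero (G d ^ K)
      G^K≢0 zero     s K _   eK rewrite m+n≡0⇒m≡0 K eK = _
      G^K≢0 (suc d′) s K d≤N eK = m^n≢0 (G (suc d′)) K {{G≢0 d′ d≤N}}

      bound : .{{_ : NonZero F}} → .{{_ : NonZero m}} → Bound S
      bound = ^-cancelˡ-≤ (m * F) {{m*n≢0 m F}} (*-cancelʳ-≤ _ _ (prod (λ u → G (deg S u) ^ K u))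
        {{prod≢0 λ u → G^K≢0 (deg S u) (S u) (K u) (deg≤N S u) (K-count u (S u) refl)}} (begin
        (F ^ (2 * L)) ^ (m * F) * PK
          ≡⟨ cong (_* PK) (trans (^-*-assoc F (2 * L) (m * F))
              (trans (cong (F ^_) (*-comm (2 * L) (m * F))) (sym (^-*-assoc F (m * F) (2 * L))))) ⟩
        (F ^ (m * F)) ^ (2 * L) * PK
          ≤⟨ *-monoˡ-≤ PK (^-monoˡ-≤ (2 * L) entropies) ⟩
        (W * D) ^ (2 * L) * PK
          ≡⟨ trans (cong (_* PK) (^-distribʳ-* (2 * L) W D)) (regroup (W ^ (2 * L)) (D ^ (2 * L)) PK) ⟩
        D ^ (2 * L) * (W ^ (2 * L) * PK)
          ≤⟨ *-monoʳ-≤ (D ^ (2 * L)) global ⟩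
        D ^ (2 * L) * (prod (λ u → G (deg S u) ^ T u) * prod (λ u → G (pred (deg S u)) ^ K u))
          ≡⟨ cong₂ _*_ (prod-^ (λ u → deg S u ^ (χ (S u) * F)) (2 * L))
              (∏-distrib-* (λ u → G (deg S u) ^ T u) (λ u → G (pred (deg S u)) ^ K u)) ⟨
        prod (λ u → (deg S u ^ (χ (S u) * F)) ^ (2 * L)) * prod
            (λ u → G (deg S u) ^ T u * G (pred (deg S u)) ^ K u)
          ≡⟨ ∏-distrib-* (λ u → (deg S u ^ (χ (S u) * F)) ^ (2 * L))
              (λ u → G (deg S u) ^ T u * G (pred (deg S u)) ^ K u) ⟨
        prod (λ u → (deg S u ^ (χ (S u) * F)) ^ (2 * L) * (G (deg S u) ^ T u * G (pred (deg S u)) ^ K u))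
          ≡⟨ prod-cong-≗ (λ u → balance (deg S u) (S u) (T u) (K u) (deg≤N S u) (T-count u (S u) refl)
              (K-count u (S u) refl)) ⟩
        prod (λ u → (G (deg S u) ^ χ (S u)) ^ (m * F) * G (deg S u) ^ K u)
          ≡⟨ ∏-distrib-* (λ u → (G (deg S u) ^ χ (S u)) ^ (m * F)) (λ u → G (deg S u) ^ K u) ⟩
        prod (λ u → (G (deg S u) ^ χ (S u)) ^ (m * F)) * PK
          ≡⟨ cong (_* PK) (prod-^ (λ u → G (deg S u) ^ χ (S u)) (m * F)) ⟩
        prod (λ u → G (deg S u) ^ χ (S u)) ^ (m * F) * PK ∎))
        where
        open ≤-Reasoning
        D PK : ℕ
        D = prod (λ u → deg S u ^ (χ (S u) * F))
        PK = prod (λ u → G (deg S u) ^ K u)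
        regroup : ∀ a b c → a * b * c ≡ b * (a * c)
        regroup = solve-∀

  -- Induction on the number of vertices

  size : VertexSet N → ℕ
  size S = sum (χ ∘ S)

  size-∖∖ : ∀ S {v w} → S v ≡ true → S w ≡ true → v ≢ w → 2 + size (S ∖ v ∖ w) ≡ size S
  size-∖∖ S {v} {w} Sv Sw v≢w = trans (shift (size (S ∖ v ∖ w))) (trans
    (cong (λ t → t + 1 + 1) (sum-cong-≗ (λ x → sym (*-identityʳ (χ ((S ∖ v ∖ w) x))))))
    (trans (∑-∖∖ S Sv Sw v≢w (λ _ → 1)) (sum-cong-≗ (λ x → *-identityʳ (χ (S x))))))
    where
    shift : ∀ t → 2 + t ≡ t + 1 + 1
    shift = solve-∀

  -- The number `k` drives the recursion, since a set with two vertices deleted is not structurally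
  -- smaller. Empty sets and sets with `h S` = 0 are settled directly, because `bound` extracts a
  -- root of order `m * F`.
  haf-bound : ∀ k S → size S ≤ k → Bound S
  haf-bound k S size≤k with size S ≟ 0 | h S ≟ 0
  ... | yes m≡0 | _ = ≤-trans (^-monoˡ-≤ (2 * L)
      (haf-empty A (pairs N) (λ v → χ≡0 (S v) (sum≡0⇒ (χ ∘ S) m≡0 v))))
    (≤-reflexive (trans (^-zeroˡ (2 * L)) (sym
        (prod-one (λ u → cong (G (deg S u) ^_) (sum≡0⇒ (χ ∘ S) m≡0 u))))))
    where
    χ≡0 : ∀ b → χ b ≡ 0 → b ≡ false
    χ≡0 false _ = refl
  ... | no _ | yes h≡0 = ≤-trans (≤-reflexive (trans (cong (_^ (2 * L)) h≡0) (0^ (2 * L) {{m*n≢0 2 L}}))) z≤n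
    where
    0^ : ∀ k .{{_ : NonZero k}} → 0 ^ k ≡ 0
    0^ (suc k) = refl
  haf-bound zero    S size≤k | no m≢0 | no h≢0 = contradiction (n≤0⇒n≡0 size≤k) m≢0
  haf-bound (suc k) S size≤k | no m≢0 | no h≢0 = Step.bound S
    (λ v w Sv Sw v≢w → haf-bound k (S ∖ v ∖ w)
      (≤-trans (n≤1+n _) (s≤s⁻¹ (≤-trans (≤-reflexive (size-∖∖ S Sv Sw v≢w)) size≤k))))
    {{≢-nonZero h≢0}} {{≢-nonZero m≢0}}

-- Roots of factorials

-- The L-th power of (d !) ^ (1 / d) when d ∣ L; the value at 0 follows the convention 0 ^ (1 / 0) = 0.
factorialRoot : ℕ → ℕ → ℕ
factorialRoot L zero      = 0
factorialRoot L d@(suc _) = (d !) ^ (L / d)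

-- All degrees are at most `N`, so `N !` can serve as their common multiple `L`: `suc d` divides its
-- own factorial, which divides `N !`.
L/d*d≡L : ∀ N d → suc d ≤ N → N ! / suc d * suc d ≡ N !
L/d*d≡L N d d<N = m/n*n≡m (∣-trans (m∣m*n (d !)) (m≤n⇒m!∣n! d<N))

factorialRoot-^ : ∀ N d → d ≤ N → factorialRoot (N !) d ^ d ≡ (d !) ^ (N !)
factorialRoot-^ N zero    _   = sym (^-zeroˡ (N !))
factorialRoot-^ N (suc d) d<N = trans (^-*-assoc (suc d !) (N ! / suc d) (suc d))
  (cong ((suc d !) ^_) (L/d*d≡L N d d<N))

rowSum≡sum : ∀ {N} (A : Matrix N) u → rowSum A u ≡ sum (A u)
rowSum≡sum A u = ∑ₗ-tabulate id (A u)

rowSum≤ : ∀ {N} (A : Matrix N) → Is01 A → ∀ u → rowSum A u ≤ N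
rowSum≤ A A-01 u = subst (_≤ _) (sym (rowSum≡sum A u)) (sum-≤1 (A u) A≤1)
  where
  A≤1 : ∀ w → A u w ≤ 1
  A≤1 w with A-01 u w
  ... | inj₁ eq = ≤-trans (≤-reflexive eq) z≤n
  ... | inj₂ eq = ≤-reflexive eq

hafn-bound : ∀ {N} (A : Matrix N) → Is01 A → IsSymmetric A → ZeroDiagonal A →
  hafn A ^ (2 * N !) ≤ prod (λ u → factorialRoot (N !) (rowSum A u))
hafn-bound {N} A A-01 A-sym A-diag = subst₂ _≤_
  -- On the full vertex set `IsPerfectOn` unfolds to `IsPerfect`, because `χ true` is 1, so the sum
  -- is already `hafn A`.
  (cong (_^ (2 * N !)) (haf≡∑ A (pairs N) ⊤))
  (prod-cong-≗ (λ u → trans (*-identityʳ _) (cong (factorialRoot (N !))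
    (trans (sum-cong-≗ (λ w → *-identityˡ (A u w))) (sym (rowSum≡sum A u))))))
  (Induction.haf-bound A A-01 A-sym A-diag (N !) {{N !≢0}} (factorialRoot (N !)) refl (factorialRoot-^ N) _
      ⊤ ≤-refl)
  where
  ⊤ : VertexSet N
  ⊤ _ = true

-- The `j`-th term of the sequence for the root is `c / suc j`, where `c` is a root rounded up.
-- Rounding up makes each term an upper approximation, which gives the inequality after raising to
-- the power `N ! / r`. For `r` = 0 both conventions give 0.
root-numerator : ∀ N r → r ≤ N → ∀ j → ∃ λ c →
  seq ((r !) ^[1/ 2 * r ]) j ℚ.* ι (suc j) ≡ ι c ×
  factorialRoot (N !) r * suc j ^ (2 * N !) ≤ c ^ (2 * N !)
root-numerator N zero    _   j = 0 , ℚ.*-zeroˡ (ι (suc j)) , z≤n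
root-numerator N r@(suc r′) r≤N j = c , /-*ι c j , (begin
  (r !) ^ q * suc j ^ (2 * N !)          ≡⟨ cong (λ e → (r !) ^ q * suc j ^ e) exponent ⟨
  (r !) ^ q * suc j ^ (m * q)            ≡⟨ cong ((r !) ^ q *_) (^-*-assoc (suc j) m q) ⟨
  (r !) ^ q * (suc j ^ m) ^ q            ≡⟨ ^-distribʳ-* q (r !) (suc j ^ m) ⟨
  (r ! * suc j ^ m) ^ q                  ≤⟨ ^-monoˡ-≤ q (⌈^1/⌉-upper (r ! * suc j ^ m) m) ⟩
  (c ^ m) ^ q                            ≡⟨ ^-*-assoc c m q ⟩
  c ^ (m * q)                            ≡⟨ cong (c ^_) exponent ⟩
  c ^ (2 * N !)                          ∎)
  where
  open ≤-Reasoning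
  m q c : ℕ
  m = 2 * r
  q = N ! / r
  c = Root.num (r !) m j
  exponent : m * q ≡ 2 * N !
  exponent = trans (*-assoc 2 r q) (cong (2 *_) (trans (*-comm r q) (L/d*d≡L N r′ r≤N)))

∏-numerator : ∀ {n} (x : Vector ℝ n) (c : Fin n → ℕ) j → (∀ i → seq (x i) j ℚ.* ι (suc j) ≡ ι (c i)) →
  seq (∏ x) j ℚ.* ι (suc j ^ n) ≡ ι (prod c)
∏-numerator {zero}  x c j x≡c = refl
∏-numerator {suc n} x c j x≡c = begin
  x₀ ℚ.* xs ℚ.* ι (suc j * suc j ^ n)               ≡⟨ cong (x₀ ℚ.* xs ℚ.*_) (ι-* (suc j) (suc j ^ n)) ⟩
  x₀ ℚ.* xs ℚ.* (ι (suc j) ℚ.* ι (suc j ^ n))       ≡⟨ interchange x₀ xs (ι (suc j)) (ι (suc j ^ n)) ⟩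
  x₀ ℚ.* ι (suc j) ℚ.* (xs ℚ.* ι (suc j ^ n))       ≡⟨ cong₂ ℚ._*_ (x≡c zero)
      (∏-numerator (x ∘ suc) (c ∘ suc) j (x≡c ∘ suc)) ⟩
  ι (c zero) ℚ.* ι (prod (c ∘ suc))                 ≡⟨ ι-* (c zero) (prod (c ∘ suc)) ⟨
  ι (c zero * prod (c ∘ suc))                       ∎
  where
  open ≡-Reasoning
  x₀ xs : ℚ.ℚ
  x₀ = seq (x zero) j
  xs = seq (∏ (x ∘ suc)) j
  interchange : ∀ p q r s → p ℚ.* q ℚ.* (r ℚ.* s) ≡ p ℚ.* r ℚ.* (q ℚ.* s)
  interchange = Ring.solve-∀ ℚ-ring

-- Since every factor is approximated from above, the inequality holds at each index `j` without
-- error term. It is checked by clearing the common denominator `suc j ^ N` and comparing powers of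
-- order `2 * N !`.
roots-bound : ∀ {N} H (r : Fin N → ℕ) → (∀ u → r u ≤ N) →
  H ^ (2 * N !) ≤ prod (λ u → factorialRoot (N !) (r u)) →
  fromℕ H ≤ℝ ∏ (λ u → (r u !) ^[1/ 2 * r u ])
roots-bound {N} H r r≤N H^≤ ε {{ε>0}} = 0 , λ {j} _ → begin
  ι H                   ≤⟨ pointwise j ⟩
  R j                   ≡⟨ ℚ.+-identityʳ (R j) ⟨
  R j ℚ.+ ℚ.0ℚ          ≤⟨ ℚ.+-monoʳ-≤ (R j) (ℚ.<⇒≤ (ℚ.positive⁻¹ ε {{ε>0}})) ⟩
  R j ℚ.+ ε             ∎
  where
  open ℚ.≤-Reasoning
  R : ℕ → ℚ.ℚ
  R = seq (∏ (λ u → (r u !) ^[1/ 2 * r u ]))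
  pointwise : ∀ j → ι H ℚ.≤ R j
  pointwise j = ℚ.*-cancelʳ-≤-pos (ι (suc j ^ N)) {{ℚ.normalize-pos (suc j ^ N) 1 {{_}} {{m^n≢0 (suc j) N}}}}
      (begin
    ι H ℚ.* ι (suc j ^ N)       ≡⟨ ι-* H (suc j ^ N) ⟨
    ι (H * suc j ^ N)           ≤⟨ ι-mono-≤ (^-cancelˡ-≤ (2 * N !) {{m*n≢0 2 (N !) {{_}} {{N !≢0}}}} powers) ⟩
    ι (prod c)                  ≡⟨ ∏-numerator (λ u → (r u !) ^[1/ 2 * r u ]) c j
        (λ u → proj₁ (proj₂ (num u))) ⟨
    R j ℚ.* ι (suc j ^ N)       ∎)
    where
    num = λ u → root-numerator N (r u) (r≤N u) j
    c : Fin N → ℕ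
    c u = proj₁ (num u)
    const-prod : ∀ n x → prod {n} (λ _ → x) ≡ x ^ n
    const-prod zero    x = refl
    const-prod (suc n) x = cong (x *_) (const-prod n x)
    powers : (H * suc j ^ N) ^ (2 * N !) ≤ prod c ^ (2 * N !)
    powers = ≤-trans (≤-reflexive (^-distribʳ-* (2 * N !) H (suc j ^ N)))
      (≤-trans (*-mono-≤ H^≤ (≤-reflexive (trans (^-*-assoc (suc j) N (2 * N !))
          (trans (cong (suc j ^_) (*-comm N (2 * N !)))
        (trans (sym (^-*-assoc (suc j) (2 * N !) N)) (sym (const-prod N (suc j ^ (2 * N !)))))))))
      (≤-trans (≤-reflexive (sym (∏-distrib-* (λ u → factorialRoot (N !) (r u)) (λ _ → suc j ^ (2 * N !)))))
      (≤-trans (prod-mono-≤ (λ u → proj₂ (proj₂ (num u)))) (≤-reflexive (prod-^ c (2 * N !))))))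

-- Graphs as symmetric 0/1 matrices

module _ {N : ℕ} (G : Graph N) where
  open Graph G

  adjacency : Matrix N
  adjacency i j = χ (does (adj? i j))

  adjacency-01 : Is01 adjacency
  adjacency-01 i j with does (adj? i j)
  ... | true  = inj₂ refl
  ... | false = inj₁ refl

  adjacency-sym : IsSymmetric adjacency
  adjacency-sym i j = cong χ (does-⇔ (mk⇔ adj-sym adj-sym) (adj? i j) (adj? j i))

  adjacency-diag : ZeroDiagonal adjacency
  adjacency-diag i = cong χ (dec-false (adj? i i) (adj-irrefl refl))

  perfmat≡hafn : perfmat ≡ hafn adjacency
  perfmat≡hafn = length-filter-sublists-filter isPerfect? (λ (i , j) → adj? i j) (pairs N)

  deg≡rowSum : ∀ v → deg v ≡ rowSum adjacency v
  deg≡rowSum v = trans (length≡∑ₗ (filter (adj? v) (allFin N))) (trans (∑ₗ-filter (adj? v) (allFin N) (λ _ → 1))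
    (∑ₗ-cong (allFin N) (λ w → *-identityʳ (adjacency v w))))

  perfmat-bound : perfmat ^ (2 * N !) ≤ prod (λ v → factorialRoot (N !) (deg v))
  perfmat-bound = subst₂ _≤_ (cong (_^ (2 * N !)) (sym perfmat≡hafn))
    (prod-cong-≗ (λ v → cong (factorialRoot (N !)) (sym (deg≡rowSum v))))
    (hafn-bound adjacency adjacency-01 adjacency-sym adjacency-diag)

theorem4p1 : (∀ n (G : Graph (2 * n)) → let open Graph G in
    fromℕ perfmat ≤ℝ ∏ (λ v → (deg v !) ^[1/ 2 * deg v ]))
    ×
    (∀ n (A : Matrix (2 * n)) → Is01 A → IsSymmetric A → ZeroDiagonal A →
    fromℕ (hafn A) ≤ℝ ∏ (λ i → (rowSum A i !) ^[1/ 2 * rowSum A i ]))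
theorem4p1 =
  (λ n G → let open Graph G in roots-bound perfmat deg
     (λ v → subst (_≤ 2 * n) (sym (deg≡rowSum G v)) (rowSum≤ (adjacency G) (adjacency-01 G) v)) (perfmat-bound G)) ,
  (λ n A A-01 A-sym A-diag → roots-bound (hafn A) (rowSum A) (rowSum≤ A A-01) (hafn-bound A A-01 A-sym A-diag))
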